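{- Let $G$ be a distributive graph, $\mathfrak E$ an extensive category and $S:\mathcal F(G)\to\mathfrak E$ a distributive functor, where $\mathcal F(G)$ is the free distributive category on $G$. If no arc of $G$ is a control function, then $$S(\mathcal F(G))=\mathbf{call}[\,S(\mathcal F(G))\,].$$
   Context: A distributive category has finite sums and finite products such that the canonical arrows $X\times Y+X\times Z\to X\times(Y+Z)$ are invertible; a distributive functor is a functor which preserves finite sums and finite products. A distributive expression on a set $A$ is a term built from elements of $A$ and constants $0,1$ with binary operators $+$, $\times$. A distributive graph $G$ is a set $A$ of objects together with a directed graph (multiple arcs and loops allowed) whose vertices are the distributive expressions on $A$. The free distributive category $\mathcal F(G)$ has as objects the distributive expressions on $A$ ($+,\times,0,1$ being sum, product, initial and terminal object); its arrows are generated by the arcs of $G$, identities, injections, projections, initial and terminal maps and inverse distributivity arrows, under composition, pairing $(-,-)$ and copairing $(-\mid-)$, modulo the equations of distributive categories. The normal form of a distributive expression on $A$ is obtained by interpreting it in the free semiring on $A$ and reducing it to a sum of monomials. An arc of $G$ is a control function if the normal form of its target is a sum of at least two monomials. A category $\mathfrak E$ with finite sums is extensive if the canonical functors $\mathfrak E/A\times\mathfrak E/B\to\mathfrak E/(A+B)$ are equivalences; then pullbacks along injections exist, and any $f:C\to A+B$ is the sum of its pullbacks $f_{\lceil A}:f^{ -1}(A)\to A$ and $f_{B\rceil}:f^{ -1}(B)\to B$, with $C\cong f^{ -1}(A)+f^{ -1}(B)$. For $f:X+U\to U+Y$ in $\mathfrak E$ let $f_0=f_{|X}:X\to U+Y$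 and $f_{k+1}=f_{|U}\circ f_{k\lceil U}:f_k^{ -1}(U)\to U+Y$ (where $f_{|X}$, $f_{|U}$ denote restrictions along the injections). The iteration of $f$ terminates if $\sum_{k\ge0}f_k^{ -1}(Y)\cong X$, the isomorphism being given by the injections $f_k^{ -1}(Y)\to X$; in this case the arrow which $f$ computes by iteration is $\mathbf{call}[f]:X\to Y$, given on the summand $f_k^{ -1}(Y)$ by $f_{kY\rceil}$. For a subcategory with finite sums $\mathfrak C$ of $\mathfrak E$, the iterative closure $\mathbf{call}[\mathfrak C]$ of $\mathfrak C$ in $\mathfrak E$ is formed by the arrows $\mathbf{call}[f]$ computed by iteration by the terminating arrows $f:X+U\to U+Y$ lying in $\mathfrak C$. An arrow $f:X+U\to U+Y$ is finitely iterable if $f_k^{ -1}(Y)\cong\varnothing$ for all sufficiently large $k$; when all such arrows of $\mathfrak C$ are finitely iterable, the sums above reduce to finite sums and $\mathbf{call}[\mathfrak C]$ is defined even if $\mathfrak E$ does not have countable sums. $S(\mathcal F(G))$ denotes the image of $\mathcal F(G)$ in $\mathfrak E$ under $S$.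
   Formalization: The image S(F(G)), with objects named by expressions, is enlarged by all arrows out of S(z) whenever S(z) is initial, closed under composition and copairing; with the plain image the claim fails if S sends an atom to an initial object. If only z≅0 has S(z) initial, it is the plain image. -}

module Defs where

open import Level using (Level; _⊔_) renaming (suc to lsuc)
open import Data.List using (List; []; _∷_; _++_; length; cartesianProductWith)
open import Data.Nat using (ℕ; zero; suc; _≤_)
open import Data.Product using (Σ; Σ-syntax; _×_; _,_; proj₁; proj₂)
open import Relation.Binary.Structures using (IsEquivalence)
open import Relation.Binary.Bundles using (Setoid)
import Relation.Binary.Reasoning.Setoid as SetoidReasoning

record Category (o ℓ e : Level) : Set (lsuc (o ⊔ ℓ ⊔ e)) where
  infix  4 _≈_ _⇒_
  infixr 9 _∘_
  field
    Obj    : Set o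
    _⇒_    : Obj → Obj → Set ℓ
    _≈_    : ∀ {A B} → A ⇒ B → A ⇒ B → Set e
    id     : ∀ {A} → A ⇒ A
    _∘_    : ∀ {A B C} → B ⇒ C → A ⇒ B → A ⇒ C
    equiv  : ∀ {A B} → IsEquivalence (_≈_ {A} {B})
    ∘-resp : ∀ {A B C} {f f′ : B ⇒ C} {g g′ : A ⇒ B} →
             f ≈ f′ → g ≈ g′ → f ∘ g ≈ f′ ∘ g′
    idˡ    : ∀ {A B} {f : A ⇒ B} → id ∘ f ≈ f
    idʳ    : ∀ {A B} {f : A ⇒ B} → f ∘ id ≈ f
    assoc  : ∀ {A B C D} {f : A ⇒ B} {g : B ⇒ C} {h : C ⇒ D} →
             (h ∘ g) ∘ f ≈ h ∘ (g ∘ f)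

  hom : Obj → Obj → Setoid ℓ e
  hom A B = record { Carrier = A ⇒ B ; _≈_ = _≈_ ; isEquivalence = equiv }

  module Eq {A B} = IsEquivalence (equiv {A} {B})
  module HomReasoning {A B} = SetoidReasoning (hom A B)

module _ {o ℓ e} (C : Category o ℓ e) where
  open Category C

  record IsIso {A B} (f : A ⇒ B) : Set (ℓ ⊔ e) where
    field
      inv  : B ⇒ A
      invˡ : inv ∘ f ≈ id
      invʳ : f ∘ inv ≈ id

  record IsInitial (I : Obj) : Set (o ⊔ ℓ ⊔ e) where
    field
      initial  : ∀ {Z} → I ⇒ Z
      initial! : ∀ {Z} {f : I ⇒ Z} → f ≈ initial

  record IsTerminal (T : Obj) : Set (o ⊔ ℓ ⊔ e) where
    field
      terminal  : ∀ {Z} → Z ⇒ T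
      terminal! : ∀ {Z} {f : Z ⇒ T} → f ≈ terminal

  record IsCoproduct {A B P} (i : A ⇒ P) (j : B ⇒ P) : Set (o ⊔ ℓ ⊔ e) where
    field
      copair  : ∀ {Z} → A ⇒ Z → B ⇒ Z → P ⇒ Z
      copair₁ : ∀ {Z} {f : A ⇒ Z} {g : B ⇒ Z} → copair f g ∘ i ≈ f
      copair₂ : ∀ {Z} {f : A ⇒ Z} {g : B ⇒ Z} → copair f g ∘ j ≈ g
      copair! : ∀ {Z} {f : A ⇒ Z} {g : B ⇒ Z} {h : P ⇒ Z} →
                h ∘ i ≈ f → h ∘ j ≈ g → h ≈ copair f g

  record IsProduct {A B P} (p : P ⇒ A) (q : P ⇒ B) : Set (o ⊔ ℓ ⊔ e) where
    field
      pair  : ∀ {Z} → Z ⇒ A → Z ⇒ B → Z ⇒ P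
      pair₁ : ∀ {Z} {f : Z ⇒ A} {g : Z ⇒ B} → p ∘ pair f g ≈ f
      pair₂ : ∀ {Z} {f : Z ⇒ A} {g : Z ⇒ B} → q ∘ pair f g ≈ g
      pair! : ∀ {Z} {f : Z ⇒ A} {g : Z ⇒ B} {h : Z ⇒ P} →
              p ∘ h ≈ f → q ∘ h ≈ g → h ≈ pair f g

  record IsSum {i} {I : Set i} {D : I → Obj} {P} (ι : ∀ k → D k ⇒ P) :
         Set (i ⊔ o ⊔ ℓ ⊔ e) where
    field
      cotuple   : ∀ {Z} → (∀ k → D k ⇒ Z) → P ⇒ Z
      cotuple-ι : ∀ {Z} {f : ∀ k → D k ⇒ Z} k → cotuple f ∘ ι k ≈ f k
      cotuple!  : ∀ {Z} {f : ∀ k → D k ⇒ Z} {h : P ⇒ Z} →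
                  (∀ k → h ∘ ι k ≈ f k) → h ≈ cotuple f

  record Pullback {A B D} (f : A ⇒ D) (g : B ⇒ D) : Set (o ⊔ ℓ ⊔ e) where
    field
      obj        : Obj
      p₁         : obj ⇒ A
      p₂         : obj ⇒ B
      commute    : f ∘ p₁ ≈ g ∘ p₂
      universal  : ∀ {Q} {h : Q ⇒ A} {k : Q ⇒ B} → f ∘ h ≈ g ∘ k → Q ⇒ obj
      universal₁ : ∀ {Q} {h : Q ⇒ A} {k : Q ⇒ B} {eq : f ∘ h ≈ g ∘ k} →
                   p₁ ∘ universal eq ≈ h
      universal₂ : ∀ {Q} {h : Q ⇒ A} {k : Q ⇒ B} {eq : f ∘ h ≈ g ∘ k} →
                   p₂ ∘ universal eq ≈ k
      unique     : ∀ {Q} {u v : Q ⇒ obj} → p₁ ∘ u ≈ p₁ ∘ v → p₂ ∘ u ≈ p₂ ∘ v → u ≈ v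

  record FiniteSums : Set (o ⊔ ℓ ⊔ e) where
    infixr 6 _+_
    field
      𝟎         : Obj
      𝟎-initial : IsInitial 𝟎
      _+_       : Obj → Obj → Obj
      inl       : ∀ {A B} → A ⇒ A + B
      inr       : ∀ {A B} → B ⇒ A + B
      +-sum     : ∀ {A B} → IsCoproduct (inl {A} {B}) (inr {A} {B})

    open IsInitial 𝟎-initial public
    module _ {A B : Obj} where
      open IsCoproduct (+-sum {A} {B}) public

    infixr 6 _+₁_
    _+₁_ : ∀ {A A′ B B′} → A ⇒ A′ → B ⇒ B′ → A + B ⇒ A′ + B′
    f +₁ g = copair (inl ∘ f) (inr ∘ g)

  record FiniteProducts : Set (o ⊔ ℓ ⊔ e) where
    infixr 7 _×′_
    field
      𝟏          : Obj
      𝟏-terminal : IsTerminal 𝟏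
      _×′_       : Obj → Obj → Obj
      fst        : ∀ {A B} → A ×′ B ⇒ A
      snd        : ∀ {A B} → A ×′ B ⇒ B
      ×-product  : ∀ {A B} → IsProduct (fst {A} {B}) (snd {A} {B})

    open IsTerminal 𝟏-terminal public
    module _ {A B : Obj} where
      open IsProduct (×-product {A} {B}) public

    infixr 7 _×₁_
    _×₁_ : ∀ {A A′ B B′} → A ⇒ A′ → B ⇒ B′ → A ×′ B ⇒ A′ ×′ B′
    f ×₁ g = pair (f ∘ fst) (g ∘ snd)

  record IsDistributive : Set (o ⊔ ℓ ⊔ e) where
    field
      sums     : FiniteSums
      products : FiniteProducts
    open FiniteSums sums
    open FiniteProducts products
    field
      distributes : ∀ {X Y Z} → IsIso (copair (id {X} ×₁ inl {Y} {Z}) (id {X} ×₁ inr {Y} {Z}))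

record Functor {o ℓ e o′ ℓ′ e′} (C : Category o ℓ e) (D : Category o′ ℓ′ e′) :
       Set (o ⊔ ℓ ⊔ e ⊔ o′ ⊔ ℓ′ ⊔ e′) where
  private
    module C = Category C
    module D = Category D
  field
    F₀     : C.Obj → D.Obj
    F₁     : ∀ {A B} → A C.⇒ B → F₀ A D.⇒ F₀ B
    F-resp : ∀ {A B} {f g : A C.⇒ B} → f C.≈ g → F₁ f D.≈ F₁ g
    F-id   : ∀ {A} → F₁ (C.id {A}) D.≈ D.id
    F-∘    : ∀ {A B X} {f : A C.⇒ B} {g : B C.⇒ X} → F₁ (g C.∘ f) D.≈ F₁ g D.∘ F₁ f

idF : ∀ {o ℓ e} {C : Category o ℓ e} → Functor C C
idF {C = C} = record
  { F₀ = λ A → A ; F₁ = λ f → f ; F-resp = λ p → p ; F-id = Eq.refl ; F-∘ = Eq.refl }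
  where open Category C

infixr 9 _∘F_
_∘F_ : ∀ {o ℓ e o′ ℓ′ e′ o″ ℓ″ e″}
       {B : Category o ℓ e} {C : Category o′ ℓ′ e′} {D : Category o″ ℓ″ e″} →
       Functor C D → Functor B C → Functor B D
_∘F_ {D = D} G F = record
  { F₀     = λ A → G.F₀ (F.F₀ A)
  ; F₁     = λ f → G.F₁ (F.F₁ f)
  ; F-resp = λ p → G.F-resp (F.F-resp p)
  ; F-id   = Eq.trans (G.F-resp F.F-id) G.F-id
  ; F-∘    = Eq.trans (G.F-resp F.F-∘) G.F-∘
  }
  where
    module G = Functor G
    module F = Functor F
    open Category D

record NaturalIso {o ℓ e o′ ℓ′ e′} {C : Category o ℓ e} {D : Category o′ ℓ′ e′}
                  (F G : Functor C D) : Set (o ⊔ ℓ ⊔ e ⊔ o′ ⊔ ℓ′ ⊔ e′) where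
  private
    module C = Category C
    module F = Functor F
    module G = Functor G
  open Category D
  field
    η       : ∀ A → F.F₀ A ⇒ G.F₀ A
    natural : ∀ {A B} (f : A C.⇒ B) → G.F₁ f ∘ η A ≈ η B ∘ F.F₁ f
    η-iso   : ∀ A → IsIso D (η A)

record IsEquivalenceOfCategories {o ℓ e o′ ℓ′ e′} {C : Category o ℓ e} {D : Category o′ ℓ′ e′}
                                 (F : Functor C D) : Set (o ⊔ ℓ ⊔ e ⊔ o′ ⊔ ℓ′ ⊔ e′) where
  field
    G  : Functor D C
    GF : NaturalIso (G ∘F F) idF
    FG : NaturalIso (F ∘F G) idF

module _ {o ℓ e} {C : Category o ℓ e} {F : Functor C C} (N : NaturalIso F idF) where
  open Category C
  open HomReasoning
  open NaturalIso N
  open Functor F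

  conjugate : ∀ {A B} (f : A ⇒ B) → f ≈ (η B ∘ F₁ f) ∘ IsIso.inv (η-iso A)
  conjugate {A} {B} f = begin
    f                                     ≈⟨ idʳ ⟨
    f ∘ id                                ≈⟨ ∘-resp Eq.refl (IsIso.invʳ (η-iso A)) ⟨
    f ∘ (η A ∘ IsIso.inv (η-iso A))       ≈⟨ assoc ⟨
    (f ∘ η A) ∘ IsIso.inv (η-iso A)       ≈⟨ ∘-resp (natural f) Eq.refl ⟩
    (η B ∘ F₁ f) ∘ IsIso.inv (η-iso A)    ∎

module _ {o ℓ e o′ ℓ′ e′} {C : Category o ℓ e} {D : Category o′ ℓ′ e′} where

  faithful : {F : Functor C D} (G : Functor D C) → NaturalIso (G ∘F F) idF →
             ∀ {A B} {f g : Category._⇒_ C A B} →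
             Category._≈_ D (Functor.F₁ F f) (Functor.F₁ F g) → Category._≈_ C f g
  faithful {F} G N {f = f} {g} p = begin
    f                                      ≈⟨ conjugate N f ⟩
    (η _ ∘ G.F₁ (F.F₁ f)) ∘ _              ≈⟨ ∘-resp (∘-resp Eq.refl (G.F-resp p)) Eq.refl ⟩
    (η _ ∘ G.F₁ (F.F₁ g)) ∘ _              ≈⟨ conjugate N g ⟨
    g                                      ∎
    where
      open Category C
      open HomReasoning
      open NaturalIso N
      module F = Functor F
      module G = Functor G

module _ {o ℓ e o′ ℓ′ e′} {C : Category o ℓ e} {D : Category o′ ℓ′ e′} {F : Functor C D}
         (equivalence : IsEquivalenceOfCategories F) where
  open IsEquivalenceOfCategories equivalence
  private
    module D = Category D
    module F = Functor F
    module G = Functor G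
  open Category C
  open HomReasoning
  open NaturalIso GF

  full : ∀ {A B} (h : F.F₀ A D.⇒ F.F₀ B) → Σ[ f ∈ A ⇒ B ] F.F₁ f D.≈ h
  full {A} {B} h = f , faithful {F = G} F FG (begin
    G.F₁ (F.F₁ f)                          ≈⟨ idˡ ⟨
    id ∘ G.F₁ (F.F₁ f)                     ≈⟨ ∘-resp (IsIso.invˡ (η-iso B)) Eq.refl ⟨
    (ηB⁻¹ ∘ η B) ∘ G.F₁ (F.F₁ f)           ≈⟨ assoc ⟩
    ηB⁻¹ ∘ (η B ∘ G.F₁ (F.F₁ f))           ≈⟨ ∘-resp Eq.refl (natural f) ⟨
    ηB⁻¹ ∘ (f ∘ η A)                       ≈⟨ ∘-resp Eq.refl assoc ⟩
    ηB⁻¹ ∘ ((η B ∘ G.F₁ h) ∘ (ηA⁻¹ ∘ η A)) ≈⟨ ∘-resp Eq.refl (∘-resp Eq.refl (IsIso.invˡ (η-iso A))) ⟩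
    ηB⁻¹ ∘ ((η B ∘ G.F₁ h) ∘ id)           ≈⟨ ∘-resp Eq.refl idʳ ⟩
    ηB⁻¹ ∘ (η B ∘ G.F₁ h)                  ≈⟨ assoc ⟨
    (ηB⁻¹ ∘ η B) ∘ G.F₁ h                  ≈⟨ ∘-resp (IsIso.invˡ (η-iso B)) Eq.refl ⟩
    id ∘ G.F₁ h                            ≈⟨ idˡ ⟩
    G.F₁ h                                 ∎)
    where
      ηA⁻¹ : A ⇒ G.F₀ (F.F₀ A)
      ηA⁻¹ = IsIso.inv (η-iso A)
      ηB⁻¹ : B ⇒ G.F₀ (F.F₀ B)
      ηB⁻¹ = IsIso.inv (η-iso B)
      f : A ⇒ B
      f = (η B ∘ G.F₁ h) ∘ ηA⁻¹

infixr 7 _×C_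
_×C_ : ∀ {o ℓ e o′ ℓ′ e′} → Category o ℓ e → Category o′ ℓ′ e′ →
       Category (o ⊔ o′) (ℓ ⊔ ℓ′) (e ⊔ e′)
C ×C D = record
  { Obj    = C.Obj × D.Obj
  ; _⇒_    = λ (A , B) (A′ , B′) → (A C.⇒ A′) × (B D.⇒ B′)
  ; _≈_    = λ (f , g) (f′ , g′) → (f C.≈ f′) × (g D.≈ g′)
  ; id     = C.id , D.id
  ; _∘_    = λ (f , g) (f′ , g′) → f C.∘ f′ , g D.∘ g′
  ; equiv  = record
    { refl  = C.Eq.refl , D.Eq.refl
    ; sym   = λ (p , q) → C.Eq.sym p , D.Eq.sym q
    ; trans = λ (p , q) (p′ , q′) → C.Eq.trans p p′ , D.Eq.trans q q′
    }
  ; ∘-resp = λ (p , q) (p′ , q′) → C.∘-resp p p′ , D.∘-resp q q′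
  ; idˡ    = C.idˡ , D.idˡ
  ; idʳ    = C.idʳ , D.idʳ
  ; assoc  = C.assoc , D.assoc
  }
  where
    module C = Category C
    module D = Category D

module _ {o ℓ e} (C : Category o ℓ e) where
  open Category C

  Slice : Obj → Category (o ⊔ ℓ) (ℓ ⊔ e) e
  Slice A = record
    { Obj    = Σ[ X ∈ Obj ] X ⇒ A
    ; _⇒_    = λ (X , f) (Y , g) → Σ[ h ∈ X ⇒ Y ] g ∘ h ≈ f
    ; _≈_    = λ (h , _) (k , _) → h ≈ k
    ; id     = id , idʳ
    ; _∘_    = λ (h , p) (k , q) →
                 h ∘ k , Eq.trans (Eq.sym assoc) (Eq.trans (∘-resp p Eq.refl) q)
    ; equiv  = record { refl = Eq.refl ; sym = Eq.sym ; trans = Eq.trans }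
    ; ∘-resp = ∘-resp
    ; idˡ    = idˡ
    ; idʳ    = idʳ
    ; assoc  = assoc
    }

module Sums {o ℓ e} {C : Category o ℓ e} (sums : FiniteSums C) where
  open Category C
  open FiniteSums sums
  open HomReasoning

  copair-∘+₁ : ∀ {A A′ B B′ Z} {f : A ⇒ A′} {g : B ⇒ B′} {h : A′ ⇒ Z} {k : B′ ⇒ Z} →
               copair h k ∘ (f +₁ g) ≈ copair (h ∘ f) (k ∘ g)
  copair-∘+₁ = copair!
    (Eq.trans assoc (Eq.trans (∘-resp Eq.refl copair₁)
      (Eq.trans (Eq.sym assoc) (∘-resp copair₁ Eq.refl))))
    (Eq.trans assoc (Eq.trans (∘-resp Eq.refl copair₂)
      (Eq.trans (Eq.sym assoc) (∘-resp copair₂ Eq.refl))))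

  copair-resp : ∀ {A B Z} {f f′ : A ⇒ Z} {g g′ : B ⇒ Z} →
                f ≈ f′ → g ≈ g′ → copair f g ≈ copair f′ g′
  copair-resp p q = copair! (Eq.trans copair₁ p) (Eq.trans copair₂ q)

  copair-ext : ∀ {A B Z} {h k : A + B ⇒ Z} → h ∘ inl ≈ k ∘ inl → h ∘ inr ≈ k ∘ inr → h ≈ k
  copair-ext p q = Eq.trans (copair! p q) (Eq.sym (copair! Eq.refl Eq.refl))

  initial-ext : ∀ {Z} {f g : 𝟎 ⇒ Z} → f ≈ g
  initial-ext = Eq.trans initial! (Eq.sym initial!)

  sliceSum : ∀ A B → Functor (Slice C A ×C Slice C B) (Slice C (A + B))
  sliceSum A B = record
    { F₀     = λ ((X , f) , (Y , g)) → X + Y , f +₁ g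
    ; F₁     = λ ((h , p) , (k , q)) → h +₁ k ,
                 Eq.trans copair-∘+₁ (copair-resp (Eq.trans assoc (∘-resp Eq.refl p))
                                                  (Eq.trans assoc (∘-resp Eq.refl q)))
    ; F-resp = λ (p , q) → copair-resp (∘-resp Eq.refl p) (∘-resp Eq.refl q)
    ; F-id   = Eq.sym (copair! (Eq.trans idˡ (Eq.sym idʳ)) (Eq.trans idˡ (Eq.sym idʳ)))
    ; F-∘    = Eq.sym (Eq.trans copair-∘+₁ (copair-resp assoc assoc))
    }

record IsExtensive {o ℓ e} (E : Category o ℓ e) : Set (o ⊔ ℓ ⊔ e) where
  field
    sums      : FiniteSums E
  open FiniteSums sums
  open Sums sums
  field
    extensive : ∀ A B → IsEquivalenceOfCategories (sliceSum A B)

module Preimage {o ℓ e} {E : Category o ℓ e} (ext : IsExtensive E) where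
  open Category E
  open IsExtensive ext
  open FiniteSums sums
  open Sums sums
  open HomReasoning

  private
    module Decomposition {A B C} (f : C ⇒ A + B) where
      open IsEquivalenceOfCategories (extensive A B)
      open NaturalIso FG

      pre : Category.Obj (Slice E A ×C Slice E B)
      pre = Functor.F₀ G (C , f)

      CA CB : Obj
      CA = proj₁ (proj₁ pre)
      CB = proj₁ (proj₂ pre)
      fA : CA ⇒ A
      fA = proj₂ (proj₁ pre)
      fB : CB ⇒ B
      fB = proj₂ (proj₂ pre)

      φ : CA + CB ⇒ C
      φ = proj₁ (η (C , f))

      φ-over : f ∘ φ ≈ fA +₁ fB
      φ-over = proj₂ (η (C , f))

      φ⁻¹ : C ⇒ CA + CB
      φ⁻¹ = proj₁ (IsIso.inv (η-iso (C , f)))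

      φ⁻¹-over : (fA +₁ fB) ∘ φ⁻¹ ≈ f
      φ⁻¹-over = proj₂ (IsIso.inv (η-iso (C , f)))

      φφ⁻¹ : φ ∘ φ⁻¹ ≈ id
      φφ⁻¹ = IsIso.invʳ (η-iso (C , f))

      φ⁻¹φ : φ⁻¹ ∘ φ ≈ id
      φ⁻¹φ = IsIso.invˡ (η-iso (C , f))

      φ-cancel : ∀ {Q} {g h : Q ⇒ CA + CB} → φ ∘ g ≈ φ ∘ h → g ≈ h
      φ-cancel {g = g} {h} p = begin
        g               ≈⟨ idˡ ⟨
        id ∘ g          ≈⟨ ∘-resp φ⁻¹φ Eq.refl ⟨
        (φ⁻¹ ∘ φ) ∘ g   ≈⟨ assoc ⟩
        φ⁻¹ ∘ (φ ∘ g)   ≈⟨ ∘-resp Eq.refl p ⟩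
        φ⁻¹ ∘ (φ ∘ h)   ≈⟨ assoc ⟨
        (φ⁻¹ ∘ φ) ∘ h   ≈⟨ ∘-resp φ⁻¹φ Eq.refl ⟩
        id ∘ h          ≈⟨ idˡ ⟩
        h               ∎

      φ⁻¹-over′ : ∀ {Q Z} {h : Q ⇒ C} {i : Z ⇒ A + B} {k : Q ⇒ Z} → f ∘ h ≈ i ∘ k →
                  (fA +₁ fB) ∘ (φ⁻¹ ∘ h) ≈ i ∘ k
      φ⁻¹-over′ {h = h} {i} {k} eq = begin
        (fA +₁ fB) ∘ (φ⁻¹ ∘ h)   ≈⟨ assoc ⟨
        ((fA +₁ fB) ∘ φ⁻¹) ∘ h   ≈⟨ ∘-resp φ⁻¹-over Eq.refl ⟩
        f ∘ h                    ≈⟨ eq ⟩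
        i ∘ k                    ∎

      module Left {Q} {h : Q ⇒ C} {k : Q ⇒ A} (eq : f ∘ h ≈ inl ∘ k) where
        lift : Σ[ m ∈ Category._⇒_ (Slice E A ×C Slice E B) ((Q , k) , (𝟎 , initial)) pre ]
               proj₁ (proj₁ m) +₁ proj₁ (proj₂ m) ≈ copair (φ⁻¹ ∘ h) initial
        lift = full (extensive A B) (copair (φ⁻¹ ∘ h) initial , copair-ext
          (Eq.trans assoc (Eq.trans (∘-resp Eq.refl copair₁)
            (Eq.trans (φ⁻¹-over′ eq) (Eq.sym copair₁))))
          initial-ext)

        u : Q ⇒ CA
        u = proj₁ (proj₁ (proj₁ lift))

        u₁ : (φ ∘ inl) ∘ u ≈ h
        u₁ = begin
          (φ ∘ inl) ∘ u                              ≈⟨ assoc ⟩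
          φ ∘ (inl ∘ u)                              ≈⟨ ∘-resp Eq.refl copair₁ ⟨
          φ ∘ ((u +₁ proj₁ (proj₂ (proj₁ lift))) ∘ inl) ≈⟨ ∘-resp Eq.refl (∘-resp (proj₂ lift) Eq.refl) ⟩
          φ ∘ (copair (φ⁻¹ ∘ h) initial ∘ inl)       ≈⟨ ∘-resp Eq.refl copair₁ ⟩
          φ ∘ (φ⁻¹ ∘ h)                              ≈⟨ assoc ⟨
          (φ ∘ φ⁻¹) ∘ h                              ≈⟨ ∘-resp φφ⁻¹ Eq.refl ⟩
          id ∘ h                                     ≈⟨ idˡ ⟩
          h                                          ∎

        u₂ : fA ∘ u ≈ k
        u₂ = proj₂ (proj₁ (proj₁ lift))

      module Right {Q} {h : Q ⇒ C} {k : Q ⇒ B} (eq : f ∘ h ≈ inr ∘ k) where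
        lift : Σ[ m ∈ Category._⇒_ (Slice E A ×C Slice E B) ((𝟎 , initial) , (Q , k)) pre ]
               proj₁ (proj₁ m) +₁ proj₁ (proj₂ m) ≈ copair initial (φ⁻¹ ∘ h)
        lift = full (extensive A B) (copair initial (φ⁻¹ ∘ h) , copair-ext
          initial-ext
          (Eq.trans assoc (Eq.trans (∘-resp Eq.refl copair₂)
            (Eq.trans (φ⁻¹-over′ eq) (Eq.sym copair₂)))))

        u : Q ⇒ CB
        u = proj₁ (proj₂ (proj₁ lift))

        u₁ : (φ ∘ inr) ∘ u ≈ h
        u₁ = begin
          (φ ∘ inr) ∘ u                              ≈⟨ assoc ⟩
          φ ∘ (inr ∘ u)                              ≈⟨ ∘-resp Eq.refl copair₂ ⟨
          φ ∘ ((proj₁ (proj₁ (proj₁ lift)) +₁ u) ∘ inr) ≈⟨ ∘-resp Eq.refl (∘-resp (proj₂ lift) Eq.refl) ⟩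
          φ ∘ (copair initial (φ⁻¹ ∘ h) ∘ inr)       ≈⟨ ∘-resp Eq.refl copair₂ ⟩
          φ ∘ (φ⁻¹ ∘ h)                              ≈⟨ assoc ⟨
          (φ ∘ φ⁻¹) ∘ h                              ≈⟨ ∘-resp φφ⁻¹ Eq.refl ⟩
          id ∘ h                                     ≈⟨ idˡ ⟩
          h                                          ∎

        u₂ : fB ∘ u ≈ k
        u₂ = proj₂ (proj₂ (proj₁ lift))

  preimageˡ : ∀ {A B C} (f : C ⇒ A + B) → Pullback E f (inl {A} {B})
  preimageˡ {A} {B} {C} f = record
    { obj        = CA
    ; p₁         = φ ∘ inl
    ; p₂         = fA
    ; commute    = Eq.trans (Eq.sym assoc) (Eq.trans (∘-resp φ-over Eq.refl) copair₁)
    ; universal  = Left.u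
    ; universal₁ = λ {_} {_} {_} {eq} → Left.u₁ eq
    ; universal₂ = λ {_} {_} {_} {eq} → Left.u₂ eq
    ; unique     = λ {Q} {u} {v} p q →
        proj₁ (faithful {F = sliceSum A B} G GF {A = (Q , fA ∘ u) , (𝟎 , initial)} {B = pre}
                        {f = (u , Eq.refl) , (initial , initial-ext)}
                        {g = (v , Eq.sym q) , (initial , initial-ext)}
          (copair-resp (φ-cancel (Eq.trans (Eq.sym assoc) (Eq.trans p assoc))) Eq.refl))
    }
    where
      open Decomposition f
      open IsEquivalenceOfCategories (extensive A B)

  preimageʳ : ∀ {A B C} (f : C ⇒ A + B) → Pullback E f (inr {A} {B})
  preimageʳ {A} {B} {C} f = record
    { obj        = CB
    ; p₁         = φ ∘ inr
    ; p₂         = fB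
    ; commute    = Eq.trans (Eq.sym assoc) (Eq.trans (∘-resp φ-over Eq.refl) copair₂)
    ; universal  = Right.u
    ; universal₁ = λ {_} {_} {_} {eq} → Right.u₁ eq
    ; universal₂ = λ {_} {_} {_} {eq} → Right.u₂ eq
    ; unique     = λ {Q} {u} {v} p q →
        proj₂ (faithful {F = sliceSum A B} G GF {A = (𝟎 , initial) , (Q , fB ∘ u)} {B = pre}
                        {f = (initial , initial-ext) , (u , Eq.refl)}
                        {g = (initial , initial-ext) , (v , Eq.sym q)}
          (copair-resp Eq.refl (φ-cancel (Eq.trans (Eq.sym assoc) (Eq.trans p assoc)))))
    }
    where
      open Decomposition f
      open IsEquivalenceOfCategories (extensive A B)

module Iteration {o ℓ e} {E : Category o ℓ e} (ext : IsExtensive E) where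
  open Category E
  open IsExtensive ext
  open FiniteSums sums
  open Preimage ext

  module _ {X U Y} (f : X + U ⇒ U + Y) where

    mutual
      -- dom (suc k) is f_k⁻¹(U).
      dom : ℕ → Obj
      dom zero    = X
      dom (suc k) = Pullback.obj (preimageˡ (iterate k))

      iterate : ∀ k → dom k ⇒ U + Y
      iterate zero    = f ∘ inl
      iterate (suc k) = (f ∘ inr) ∘ Pullback.p₂ (preimageˡ (iterate k))

    dom-inj : ∀ k → dom k ⇒ X
    dom-inj zero    = id
    dom-inj (suc k) = dom-inj k ∘ Pullback.p₁ (preimageˡ (iterate k))

    exit : ℕ → Obj
    exit k = Pullback.obj (preimageʳ (iterate k))

    exit-inj : ∀ k → exit k ⇒ X
    exit-inj k = dom-inj k ∘ Pullback.p₁ (preimageʳ (iterate k))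

    exit-val : ∀ k → exit k ⇒ Y
    exit-val k = Pullback.p₂ (preimageʳ (iterate k))

    -- X itself is required to be the sum of the exit domains, so E need not
    -- have countable sums.
    Terminates : Set (o ⊔ ℓ ⊔ e)
    Terminates = IsSum E exit-inj

    call : Terminates → X ⇒ Y
    call t = IsSum.cotuple t exit-val

-- A subcategory is given by a family ⟦_⟧ of objects of E and a class of arrows
-- between them.  The family need not be injective, and the sums of the
-- subcategory are sums of names: a decomposition of an object as a sum belongs to
-- its name, not to its value.  Otherwise an isomorphism N ≅ N + N in E would turn
-- every arrow N ⇒ N of the subcategory into one that can be iterated.
record SubcategoryWithSums {o ℓ e} (E : Category o ℓ e) (n m : Level) :
       Set (o ⊔ ℓ ⊔ e ⊔ lsuc (n ⊔ m)) where
  open Category E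
  infixr 6 _⊕_
  field
    Name     : Set n
    ⟦_⟧      : Name → Obj
    Member   : ∀ {x y} → ⟦ x ⟧ ⇒ ⟦ y ⟧ → Set m
    resp∈    : ∀ {x y} {f g : ⟦ x ⟧ ⇒ ⟦ y ⟧} → f ≈ g → Member {x} {y} f → Member {x} {y} g
    id∈      : ∀ {x} → Member {x} {x} id
    ∘∈       : ∀ {x y z} {g : ⟦ y ⟧ ⇒ ⟦ z ⟧} {f : ⟦ x ⟧ ⇒ ⟦ y ⟧} →
               Member {y} {z} g → Member {x} {y} f → Member {x} {z} (g ∘ f)
    𝟘        : Name
    𝟘-init   : IsInitial E ⟦ 𝟘 ⟧
    initial∈ : ∀ {y} (f : ⟦ 𝟘 ⟧ ⇒ ⟦ y ⟧) → Member {𝟘} {y} f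
    _⊕_      : Name → Name → Name
    ιˡ       : ∀ {x y} → ⟦ x ⟧ ⇒ ⟦ x ⊕ y ⟧
    ιʳ       : ∀ {x y} → ⟦ y ⟧ ⇒ ⟦ x ⊕ y ⟧
    ⊕-sum    : ∀ {x y} → IsCoproduct E (ιˡ {x} {y}) (ιʳ {x} {y})
    ιˡ∈      : ∀ {x y} → Member {x} {x ⊕ y} ιˡ
    ιʳ∈      : ∀ {x y} → Member {y} {x ⊕ y} ιʳ
    copair∈  : ∀ {x y z} (f : ⟦ x ⊕ y ⟧ ⇒ ⟦ z ⟧) →
               Member {x} {z} (f ∘ ιˡ) → Member {y} {z} (f ∘ ιʳ) → Member {x ⊕ y} {z} f

module _ {o ℓ e n m} {E : Category o ℓ e} (ext : IsExtensive E)
         (C : SubcategoryWithSums E n m) where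
  open Category E
  open IsExtensive ext
  open FiniteSums sums
  open Iteration ext
  open SubcategoryWithSums C

  -- f transported along the canonical isomorphisms between the sums of C and the
  -- chosen sums of E.
  onSums : ∀ {x u y} → ⟦ x ⊕ u ⟧ ⇒ ⟦ u ⊕ y ⟧ → ⟦ x ⟧ + ⟦ u ⟧ ⇒ ⟦ u ⟧ + ⟦ y ⟧
  onSums f = IsCoproduct.copair ⊕-sum inl inr ∘ f ∘ copair ιˡ ιʳ

  IterativeClosure : ∀ {x y} → ⟦ x ⟧ ⇒ ⟦ y ⟧ → Set (o ⊔ ℓ ⊔ e ⊔ n ⊔ m)
  IterativeClosure {x} {y} h =
    Σ[ u ∈ Name ] Σ[ f ∈ ⟦ x ⊕ u ⟧ ⇒ ⟦ u ⊕ y ⟧ ]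
      Member {x ⊕ u} {u ⊕ y} f ×
      (Σ[ t ∈ Terminates (onSums f) ] h ≈ call (onSums f) t)

data Expr {a} (A : Set a) : Set a where
  atom    : A → Expr A
  𝟘 𝟙     : Expr A
  _⊕_ _⊗_ : Expr A → Expr A → Expr A

infixr 6 _⊕_
infixr 7 _⊗_

-- A formal sum (outer list) of monomials (inner lists); repeated monomials are
-- kept, as in the free semiring.
normalForm : ∀ {a} {A : Set a} → Expr A → List (List A)
normalForm (atom x) = (x ∷ []) ∷ []
normalForm 𝟘        = []
normalForm 𝟙        = [] ∷ []
normalForm (s ⊕ t)  = normalForm s ++ normalForm t
normalForm (s ⊗ t)  = cartesianProductWith _++_ (normalForm s) (normalForm t)

record DistributiveGraph (a g : Level) : Set (lsuc (a ⊔ g)) where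
  field
    Object : Set a
    Arc    : Expr Object → Expr Object → Set g

  IsControlFunction : ∀ {x y} → Arc x y → Set
  IsControlFunction {y = y} _ = 2 ≤ length (normalForm y)

module Free {a g} (G : DistributiveGraph a g) where
  open DistributiveGraph G

  infix  4 _⟶_ _∼_
  infixr 9 _∙_

  data _⟶_ : Expr Object → Expr Object → Set (a ⊔ g) where
    arc     : ∀ {x y} → Arc x y → x ⟶ y
    idₜ     : ∀ {x} → x ⟶ x
    _∙_     : ∀ {x y z} → y ⟶ z → x ⟶ y → x ⟶ z
    ¡       : ∀ {x} → 𝟘 ⟶ x
    !       : ∀ {x} → x ⟶ 𝟙
    in₁     : ∀ {x y} → x ⟶ x ⊕ y
    in₂     : ∀ {x y} → y ⟶ x ⊕ y
    [_∣_]   : ∀ {x y z} → x ⟶ z → y ⟶ z → x ⊕ y ⟶ z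
    pr₁     : ∀ {x y} → x ⊗ y ⟶ x
    pr₂     : ∀ {x y} → x ⊗ y ⟶ y
    ⟨_,_⟩   : ∀ {x y z} → z ⟶ x → z ⟶ y → z ⟶ x ⊗ y
    dist⁻¹  : ∀ {x y z} → x ⊗ (y ⊕ z) ⟶ x ⊗ y ⊕ x ⊗ z

  dist : ∀ {x y z} → x ⊗ y ⊕ x ⊗ z ⟶ x ⊗ (y ⊕ z)
  dist = [ ⟨ idₜ ∙ pr₁ , in₁ ∙ pr₂ ⟩ ∣ ⟨ idₜ ∙ pr₁ , in₂ ∙ pr₂ ⟩ ]

  data _∼_ : ∀ {x y} → x ⟶ y → x ⟶ y → Set (a ⊔ g) where
    ∼refl   : ∀ {x y} {f : x ⟶ y} → f ∼ f
    ∼sym    : ∀ {x y} {f f′ : x ⟶ y} → f ∼ f′ → f′ ∼ f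
    ∼trans  : ∀ {x y} {f f′ f″ : x ⟶ y} → f ∼ f′ → f′ ∼ f″ → f ∼ f″
    ∙-resp  : ∀ {x y z} {f f′ : y ⟶ z} {h h′ : x ⟶ y} → f ∼ f′ → h ∼ h′ → f ∙ h ∼ f′ ∙ h′
    ∙-idˡ   : ∀ {x y} {f : x ⟶ y} → idₜ ∙ f ∼ f
    ∙-idʳ   : ∀ {x y} {f : x ⟶ y} → f ∙ idₜ ∼ f
    ∙-assoc : ∀ {x y z w} {f : x ⟶ y} {h : y ⟶ z} {k : z ⟶ w} → (k ∙ h) ∙ f ∼ k ∙ (h ∙ f)
    ¡-uniq  : ∀ {x} {f : 𝟘 ⟶ x} → f ∼ ¡
    !-uniq  : ∀ {x} {f : x ⟶ 𝟙} → f ∼ !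
    [∣]-β₁  : ∀ {x y z} {f : x ⟶ z} {h : y ⟶ z} → [ f ∣ h ] ∙ in₁ ∼ f
    [∣]-β₂  : ∀ {x y z} {f : x ⟶ z} {h : y ⟶ z} → [ f ∣ h ] ∙ in₂ ∼ h
    [∣]-η   : ∀ {x y z} {f : x ⟶ z} {h : y ⟶ z} {k : x ⊕ y ⟶ z} →
              k ∙ in₁ ∼ f → k ∙ in₂ ∼ h → k ∼ [ f ∣ h ]
    ⟨,⟩-β₁  : ∀ {x y z} {f : z ⟶ x} {h : z ⟶ y} → pr₁ ∙ ⟨ f , h ⟩ ∼ f
    ⟨,⟩-β₂  : ∀ {x y z} {f : z ⟶ x} {h : z ⟶ y} → pr₂ ∙ ⟨ f , h ⟩ ∼ h
    ⟨,⟩-η   : ∀ {x y z} {f : z ⟶ x} {h : z ⟶ y} {k : z ⟶ x ⊗ y} →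
              pr₁ ∙ k ∼ f → pr₂ ∙ k ∼ h → k ∼ ⟨ f , h ⟩
    distˡ   : ∀ {x y z} → dist⁻¹ ∙ dist {x} {y} {z} ∼ idₜ
    distʳ   : ∀ {x y z} → dist {x} {y} {z} ∙ dist⁻¹ ∼ idₜ

  𝓕 : Category a (a ⊔ g) (a ⊔ g)
  𝓕 = record
    { Obj    = Expr Object
    ; _⇒_    = _⟶_
    ; _≈_    = _∼_
    ; id     = idₜ
    ; _∘_    = _∙_
    ; equiv  = record { refl = ∼refl ; sym = ∼sym ; trans = ∼trans }
    ; ∘-resp = ∙-resp
    ; idˡ    = ∙-idˡ
    ; idʳ    = ∙-idʳ
    ; assoc  = ∙-assoc
    }

  𝓕-sums : FiniteSums 𝓕
  𝓕-sums = record
    { 𝟎         = 𝟘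
    ; 𝟎-initial = record { initial = ¡ ; initial! = ¡-uniq }
    ; _+_       = _⊕_
    ; inl       = in₁
    ; inr       = in₂
    ; +-sum     = record
      { copair = [_∣_] ; copair₁ = [∣]-β₁ ; copair₂ = [∣]-β₂ ; copair! = [∣]-η }
    }

  𝓕-products : FiniteProducts 𝓕
  𝓕-products = record
    { 𝟏          = 𝟙
    ; 𝟏-terminal = record { terminal = ! ; terminal! = !-uniq }
    ; _×′_       = _⊗_
    ; fst        = pr₁
    ; snd        = pr₂
    ; ×-product  = record
      { pair = ⟨_,_⟩ ; pair₁ = ⟨,⟩-β₁ ; pair₂ = ⟨,⟩-β₂ ; pair! = ⟨,⟩-η }
    }

  𝓕-distributive : IsDistributive 𝓕
  𝓕-distributive = record
    { sums        = 𝓕-sums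
    ; products    = 𝓕-products
    ; distributes = record { inv = dist⁻¹ ; invˡ = distˡ ; invʳ = distʳ }
    }

open Free using (𝓕; 𝓕-sums) public

record DistributiveFunctor {o ℓ e o′ ℓ′ e′} (C : Category o ℓ e) (D : Category o′ ℓ′ e′) :
       Set (o ⊔ ℓ ⊔ e ⊔ o′ ⊔ ℓ′ ⊔ e′) where
  field
    functor : Functor C D
  open Functor functor public
  open Category C
  field
    preserves-initial   : ∀ {I} → IsInitial C I → IsInitial D (F₀ I)
    preserves-coproduct : ∀ {A B P} {i : A ⇒ P} {j : B ⇒ P} →
                          IsCoproduct C i j → IsCoproduct D (F₁ i) (F₁ j)
    preserves-terminal  : ∀ {T} → IsTerminal C T → IsTerminal D (F₀ T)
    preserves-product   : ∀ {A B P} {p : P ⇒ A} {q : P ⇒ B} →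
                          IsProduct C p q → IsProduct D (F₁ p) (F₁ q)

module _ {a g o ℓ e} {G : DistributiveGraph a g} {E : Category o ℓ e}
         (S : DistributiveFunctor (𝓕 G) E) where
  open DistributiveGraph G
  open DistributiveFunctor S
  open Category E
  open Free G using (_⟶_; in₁; in₂; idₜ; ¡)

  -- The image of S as a subcategory with finite sums.  Initial objects of E are
  -- identified, as they are in the category of sets: when S z is initial, the
  -- arrow S z ⇒ S y is the image of ¡ : 𝟘 ⟶ y, even if there is no arrow z ⟶ y
  -- (say z and y are distinct atoms).  The last two constructors close under the
  -- effect of this identification on sums and composites; if S z is initial only
  -- for z ≅ 𝟘, the class consists of the arrows S f alone.
  data InImage : ∀ {x y} → F₀ x ⇒ F₀ y → Set (a ⊔ g ⊔ o ⊔ ℓ ⊔ e) where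
    image   : ∀ {x y} (f : x ⟶ y) {h : F₀ x ⇒ F₀ y} → h ≈ F₁ f → InImage {x} {y} h
    initial : ∀ {z y} → IsInitial E (F₀ z) → (h : F₀ z ⇒ F₀ y) → InImage {z} {y} h
    copair  : ∀ {x₁ x₂ y} (h : F₀ (x₁ ⊕ x₂) ⇒ F₀ y) →
              InImage {x₁} {y} (h ∘ F₁ in₁) → InImage {x₂} {y} (h ∘ F₁ in₂) →
              InImage {x₁ ⊕ x₂} {y} h
    compose : ∀ {x y z} {k : F₀ y ⇒ F₀ z} {h : F₀ x ⇒ F₀ y} {l : F₀ x ⇒ F₀ z} →
              l ≈ k ∘ h → InImage {y} {z} k → InImage {x} {y} h → InImage {x} {z} l

  private
    resp : ∀ {x y} {f h : F₀ x ⇒ F₀ y} → f ≈ h → InImage {x} {y} f → InImage {x} {y} h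
    resp p m = compose (Eq.trans (Eq.sym p) (Eq.sym idˡ)) (image idₜ (Eq.sym F-id)) m

  Image : SubcategoryWithSums E a (a ⊔ g ⊔ o ⊔ ℓ ⊔ e)
  Image = record
    { Name     = Expr Object
    ; ⟦_⟧      = F₀
    ; Member   = λ {x} {y} → InImage {x} {y}
    ; resp∈    = resp
    ; id∈      = image idₜ (Eq.sym F-id)
    ; ∘∈       = compose Eq.refl
    ; 𝟘        = 𝟘
    ; 𝟘-init   = preserves-initial (FiniteSums.𝟎-initial (𝓕-sums G))
    ; initial∈ = initial (preserves-initial (FiniteSums.𝟎-initial (𝓕-sums G)))
    ; _⊕_      = _⊕_
    ; ιˡ       = F₁ in₁
    ; ιʳ       = F₁ in₂
    ; ⊕-sum    = preserves-coproduct (FiniteSums.+-sum (𝓕-sums G))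
    ; ιˡ∈      = image in₁ Eq.refl
    ; ιʳ∈      = image in₂ Eq.refl
    ; copair∈  = copair
    }

{-# OPTIONS --safe #-}

-- Every object x of 𝓕 G is covered by the monomials of its normal form.  If no arc is a
-- control function, an arrow x ⟶ y of the image sends each monomial m of x into a single
-- monomial of y, unless S m is initial.  Hence an arrow x ⊕ u ⟶ u ⊕ y acts on monomials as
-- a finite deterministic automaton, and a monomial of x either leaves along an arrow of
-- 𝓕 G, or reaches an initial object, or stays in u forever.  In the last case it meets no
-- exit domain, so termination forces it to be initial; hence the computed arrow restricts
-- on every monomial to an arrow of the image.  Conversely, h is computed in one step, with
-- u = 𝟘.

module Submission where

open import Level using (Level; _⊔_)
open import Data.Empty using (⊥)
open import Data.Fin as Fin using (Fin)
import Data.Fin.Properties as Finₚ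
open import Data.List using ([]; _∷_; length; map; cartesianProductWith)
open import Data.List.Properties using (length-map; length-++)
open import Data.Maybe using (Maybe; just; nothing; _>>=_)
open import Data.Nat using (ℕ; zero; suc; _+_; _*_; _≤_; _<_; z≤n; s≤s; _∸_)
open import Data.Nat.Induction using (<-rec)
import Data.Nat.Properties as ℕₚ
open import Data.Product using (Σ-syntax; ∃; _×_; _,_; proj₁; proj₂)
open import Data.Product.Function.NonDependent.Propositional using (_×-↔_)
open import Data.Sum using (_⊎_; inj₁; inj₂)
open import Data.Sum.Function.Propositional using (_⊎-↔_)
open import Data.Unit using (⊤; tt)
open import Function.Bundles using (_⇔_; mk⇔; _↔_; module Inverse; module Injection)
open import Function.Construct.Composition using (_↔-∘_)
open import Function.Construct.Symmetry using (↔-sym)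
open import Function.Properties.Inverse using (↔⇒↣)
open import Relation.Binary.PropositionalEquality as ≡ using (_≡_)
open import Relation.Nullary using (¬_; contradiction)
open import Defs renaming (initial to fromInitial; copair to onSummands)

-- Orbits of a partial self-map of a finite set

module Orbit {A : Set} {n : ℕ} (finite : A ↔ Fin n) (δ : A → Maybe A) where

  orbit : ℕ → Maybe A → Maybe A
  orbit zero    s = s
  orbit (suc k) s = orbit k s >>= δ

  orbit-+ : ∀ i j s → orbit (i + j) s ≡ orbit i (orbit j s)
  orbit-+ zero    j s = ≡.refl
  orbit-+ (suc i) j s = ≡.cong (_>>= δ) (orbit-+ i j s)

  orbit-nothing : ∀ k → orbit k nothing ≡ nothing
  orbit-nothing zero    = ≡.refl
  orbit-nothing (suc k) = ≡.cong (_>>= δ) (orbit-nothing k)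

  Alive : Maybe A → ℕ → Set
  Alive s k = ∃ λ t → orbit k s ≡ just t

  alive-≤ : ∀ {i j s} → i ≤ j → Alive s j → Alive s i
  alive-≤ {i} {j} {s} i≤j (t , eq) with orbit i s in eqᵢ
  ... | just t′ = t′ , ≡.refl
  ... | nothing = contradiction
    (≡.trans (≡.sym (orbit-nothing (j ∸ i)))
      (≡.trans (≡.cong (orbit (j ∸ i)) (≡.sym eqᵢ))
        (≡.trans (≡.sym (orbit-+ (j ∸ i) i s))
          (≡.trans (≡.cong (λ l → orbit l s) (ℕₚ.m∸n+n≡m i≤j)) eq))))
    λ ()

  -- After time `j` everything repeats: the state at time `r + j` is the one at the earlier time
  -- `r + i`, so strong induction on `k` applies.
  recurrent : ∀ {i j s} → i < j → orbit i s ≡ orbit j s → Alive s j → ∀ k → Alive s k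
  recurrent {i} {j} {s} i<j eq alive = <-rec (Alive s) step
    where
    step : ∀ k → (∀ {l} → l < k → Alive s l) → Alive s k
    step k rec with ℕₚ.≤-total k j
    ... | inj₁ k≤j = alive-≤ k≤j alive
    ... | inj₂ j≤k = ≡.subst (λ l → Alive s l) (ℕₚ.m∸n+n≡m j≤k) (proj₁ earlier , back)
      where
      r : ℕ
      r = k ∸ j
      earlier : Alive s (r + i)
      earlier = rec (≡.subst (r + i <_) (ℕₚ.m∸n+n≡m j≤k) (ℕₚ.+-monoʳ-< r i<j))
      back : orbit (r + j) s ≡ just (proj₁ earlier)
      back = ≡.trans (orbit-+ r j s) (≡.trans (≡.cong (orbit r) (≡.sym eq))
        (≡.trans (≡.sym (orbit-+ r i s)) (proj₂ earlier)))

  -- Running `n` steps decides. An orbit alive at time `n` has visited states at `n + 1` times among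
  -- only `n` states, so two of them coincide and the orbit is periodic from there on.
  halts-or-loops : ∀ s → (∃ λ k → orbit k s ≡ nothing) ⊎ (∀ k → Alive s k)
  halts-or-loops s with orbit n s in eqₙ
  ... | nothing = inj₁ (n , eqₙ)
  ... | just t  = inj₂ (recurrent i<j eq (visited j))
    where
    visited : (k : Fin (suc n)) → Alive s (Fin.toℕ k)
    visited k = alive-≤ (Finₚ.toℕ≤pred[n] k) (t , eqₙ)
    collision : ∃ λ i → ∃ λ j → i Fin.< j ×
      Inverse.to finite (proj₁ (visited i)) ≡ Inverse.to finite (proj₁ (visited j))
    collision = Finₚ.pigeonhole (ℕₚ.n<1+n n) (λ k → Inverse.to finite (proj₁ (visited k)))
    i j : Fin (suc n)
    i = proj₁ collision
    j = proj₁ (proj₂ collision)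
    i<j : i Fin.< j
    i<j = proj₁ (proj₂ (proj₂ collision))
    eq : orbit (Fin.toℕ i) s ≡ orbit (Fin.toℕ j) s
    eq = ≡.trans (proj₂ (visited i)) (≡.trans
      (≡.cong just (Injection.injective (↔⇒↣ finite) (proj₂ (proj₂ (proj₂ collision)))))
      (≡.sym (proj₂ (visited j))))

-- Monomials of a distributive expression

length-cartesianProductWith : ∀ {a b c} {A : Set a} {B : Set b} {C : Set c}
  (f : A → B → C) xs ys → length (cartesianProductWith f xs ys) ≡ length xs * length ys
length-cartesianProductWith f []       ys = ≡.refl
length-cartesianProductWith f (x ∷ xs) ys = ≡.trans (length-++ (map (f x) ys))
  (≡.cong₂ _+_ (length-map (f x) ys) (length-cartesianProductWith f xs ys))

-- Positions of the monomials in the normal form, counted with multiplicity. The recursion follows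
-- the expression rather than the list, so that arrows can be defined along it; `monomial-count`
-- links it to `normalForm`.
Monomial : ∀ {a} {A : Set a} → Expr A → Set
Monomial (atom _) = ⊤
Monomial 𝟘        = ⊥
Monomial 𝟙        = ⊤
Monomial (s ⊕ t)  = Monomial s ⊎ Monomial t
Monomial (s ⊗ t)  = Monomial s × Monomial t

monomial-count : ∀ {a} {A : Set a} (x : Expr A) → Monomial x ↔ Fin (length (normalForm x))
monomial-count (atom _) = ↔-sym Finₚ.1↔⊤
monomial-count 𝟘        = ↔-sym Finₚ.0↔⊥
monomial-count 𝟙        = ↔-sym Finₚ.1↔⊤
monomial-count (s ⊕ t)  =
  ≡.subst (λ k → Monomial (s ⊕ t) ↔ Fin k) (≡.sym (length-++ (normalForm s)))
    (↔-sym Finₚ.+↔⊎ ↔-∘ (monomial-count s ⊎-↔ monomial-count t))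
monomial-count (s ⊗ t)  =
  ≡.subst (λ k → Monomial (s ⊗ t) ↔ Fin k)
    (≡.sym (length-cartesianProductWith _ (normalForm s) (normalForm t)))
    (↔-sym Finₚ.*↔× ↔-∘ (monomial-count s ×-↔ monomial-count t))

-- The shape in which the absence of control functions is exploited, with `x` the target of an arc.
none-or-one : ∀ {a} {A : Set a} (x : Expr A) → ¬ 2 ≤ length (normalForm x) →
              ¬ Monomial x ⊎ (Σ[ m ∈ Monomial x ] ∀ m′ → m′ ≡ m)
none-or-one x ≱2 with length (normalForm x) | monomial-count x
... | zero        | count = inj₁ λ m → contradiction (Inverse.to count m) λ ()
... | suc zero    | count = inj₂ (Inverse.from count Fin.zero , λ m →
  Injection.injective (↔⇒↣ count) (≡.trans (unique _) (≡.sym (unique _))))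
  where
  unique : (i : Fin 1) → i ≡ Fin.zero
  unique Fin.zero = ≡.refl
... | suc (suc _) | _     = contradiction (s≤s (s≤s z≤n)) ≱2

-- Composition calculus and uniqueness for sums and products

module CategoryLemmas {o ℓ e} (C : Category o ℓ e) where
  open Category C

  ∘-congˡ : ∀ {A B D} {h : B ⇒ D} {f g : A ⇒ B} → f ≈ g → h ∘ f ≈ h ∘ g
  ∘-congˡ = ∘-resp Eq.refl

  ∘-congʳ : ∀ {A B D} {h : A ⇒ B} {f g : B ⇒ D} → f ≈ g → f ∘ h ≈ g ∘ h
  ∘-congʳ p = ∘-resp p Eq.refl

  pullˡ : ∀ {A B D F} {f : D ⇒ F} {g : B ⇒ D} {h : A ⇒ B} {k : B ⇒ F} →
          f ∘ g ≈ k → f ∘ (g ∘ h) ≈ k ∘ h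
  pullˡ p = Eq.trans (Eq.sym assoc) (∘-congʳ p)

  pullʳ : ∀ {A B D F} {f : D ⇒ F} {g : B ⇒ D} {h : A ⇒ B} {k : A ⇒ D} →
          g ∘ h ≈ k → (f ∘ g) ∘ h ≈ f ∘ k
  pullʳ p = Eq.trans assoc (∘-congˡ p)

  elimˡ : ∀ {A B} {f : B ⇒ B} {g : A ⇒ B} → f ≈ id → f ∘ g ≈ g
  elimˡ p = Eq.trans (∘-congʳ p) idˡ

  elimʳ : ∀ {A B} {f : A ⇒ B} {g : A ⇒ A} → g ≈ id → f ∘ g ≈ f
  elimʳ p = Eq.trans (∘-congˡ p) idʳ

  IsCoproduct-ext : ∀ {A B P Z} {i : A ⇒ P} {j : B ⇒ P} {f g : P ⇒ Z} → IsCoproduct C i j →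
                    f ∘ i ≈ g ∘ i → f ∘ j ≈ g ∘ j → f ≈ g
  IsCoproduct-ext c p q =
    Eq.trans (IsCoproduct.copair! c p q) (Eq.sym (IsCoproduct.copair! c Eq.refl Eq.refl))

  IsProduct-ext : ∀ {A B P Z} {p : P ⇒ A} {q : P ⇒ B} {f g : Z ⇒ P} → IsProduct C p q →
                  p ∘ f ≈ p ∘ g → q ∘ f ≈ q ∘ g → f ≈ g
  IsProduct-ext c p q =
    Eq.trans (IsProduct.pair! c p q) (Eq.sym (IsProduct.pair! c Eq.refl Eq.refl))

-- Disjoint sums and strict initial object in an extensive category

module ExtensiveLemmas {o ℓ e} {E : Category o ℓ e} (ext : IsExtensive E) where
  open Category E
  open CategoryLemmas E
  open IsExtensive ext
  open FiniteSums sums renaming (_+_ to _+′_)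
  open Sums sums
  open Preimage ext
  open HomReasoning

  private
    -- By the hypothesis the exchange map `Q + 𝟎 ⇒ 𝟎 + Q` lies over `A + B`. Fullness of the
    -- extensivity functor splits it into components, the first of which is an arrow `Q ⇒ 𝟎`.
    swap : ∀ {A B Q} {a : Q ⇒ A} {b : Q ⇒ B} → inl ∘ a ≈ inr ∘ b →
           Σ[ m ∈ Category._⇒_ (Slice E A ×C Slice E B) ((Q , a) , (𝟎 , initial))
                                                          ((𝟎 , initial) , (Q , b)) ]
             proj₁ (proj₁ m) +₁ proj₁ (proj₂ m) ≈ copair inr initial
    swap {A} {B} {Q} {a} {b} p = full (extensive A B)
      {A = (Q , a) , (𝟎 , initial)} {B = (𝟎 , initial) , (Q , b)}
      (copair inr initial , copair-ext
        (begin
          (copair _ _ ∘ copair inr initial) ∘ inl ≈⟨ pullʳ copair₁ ⟩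
          copair _ _ ∘ inr                        ≈⟨ copair₂ ⟩
          inr ∘ b                                 ≈⟨ p ⟨
          inl ∘ a                                 ≈⟨ copair₁ ⟨
          copair _ _ ∘ inl                        ∎)
        initial-ext)

  disjoint : ∀ {A B Q} {a : Q ⇒ A} {b : Q ⇒ B} → inl ∘ a ≈ inr ∘ b → Q ⇒ 𝟎
  disjoint p = proj₁ (proj₁ (proj₁ (swap p)))

  -- The injections `𝟎 ⇒ 𝟎 + 𝟎` are equal, so `swap` applies to `z` on both sides. Folding the split
  -- exchange map with `copair initial id` exhibits `Q` as a retract of `𝟎`, and arrows out of a
  -- retract of `𝟎` are unique.
  strict : ∀ {Q Z} → Q ⇒ 𝟎 → {f g : Q ⇒ Z} → f ≈ g
  strict {Q} z = Eq.trans through (Eq.sym through)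
    where
    m = swap {a = z} {b = z} (∘-congʳ initial-ext)
    a : Q ⇒ 𝟎
    a = proj₁ (proj₁ (proj₁ m))
    retract : initial ∘ a ≈ id
    retract = begin
      initial ∘ a                            ≈⟨ pullˡ copair₁ ⟨
      copair initial id ∘ (inl ∘ a)          ≈⟨ ∘-congˡ copair₁ ⟨
      copair initial id ∘ (copair _ _ ∘ inl) ≈⟨ ∘-congˡ (∘-congʳ (proj₂ m)) ⟩
      copair initial id ∘ (copair _ _ ∘ inl) ≈⟨ ∘-congˡ copair₁ ⟩
      copair initial id ∘ inr                ≈⟨ copair₂ ⟩
      id                                     ∎
    through : ∀ {Z} {f : Q ⇒ Z} → f ≈ initial ∘ a
    through {f = f} = begin
      f                   ≈⟨ elimʳ retract ⟨
      f ∘ (initial ∘ a)   ≈⟨ pullˡ initial-ext ⟩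
      initial ∘ a         ∎

  strict-initial : ∀ {Q} → Q ⇒ 𝟎 → IsInitial E Q
  strict-initial z = record { initial = initial ∘ z ; initial! = strict z }

  -- The identity of `Q + 𝟎` is an arrow over `A + B` from the sum of `a` and `initial` to that of
  -- `b` and `initial`. Fullness writes it as a sum with first component `u` satisfying `b ∘ u ≈ a`,
  -- and folding shows that `u` is the identity.
  inl-mono : ∀ {A B Q} {a b : Q ⇒ A} → inl {A} {B} ∘ a ≈ inl ∘ b → a ≈ b
  inl-mono {A} {B} {Q} {a} {b} p = begin
    a      ≈⟨ proj₂ (proj₁ (proj₁ m)) ⟨
    b ∘ u  ≈⟨ elimʳ u≈id ⟩
    b      ∎
    where
    m = full (extensive A B) {A = (Q , a) , (𝟎 , initial)} {B = (Q , b) , (𝟎 , initial)}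
      (id , Eq.trans idʳ (copair-resp (Eq.sym p) initial-ext))
    u : Q ⇒ Q
    u = proj₁ (proj₁ (proj₁ m))
    u≈id : u ≈ id
    u≈id = begin
      u                                   ≈⟨ elimˡ copair₁ ⟨
      (copair id initial ∘ inl) ∘ u       ≈⟨ pullʳ (Eq.sym copair₁) ⟩
      copair id initial ∘ (_ ∘ inl)       ≈⟨ ∘-congˡ (Eq.trans (∘-congʳ (proj₂ m)) idˡ) ⟩
      copair id initial ∘ inl             ≈⟨ copair₁ ⟩
      id                                  ∎

  inr-mono : ∀ {A B Q} {a b : Q ⇒ B} → inr {A} {B} ∘ a ≈ inr ∘ b → a ≈ b
  inr-mono {A} {B} {Q} {a} {b} p = inl-mono (begin
    inl ∘ a                    ≈⟨ pullˡ copair₂ ⟨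
    copair inr inl ∘ (inr ∘ a) ≈⟨ ∘-congˡ p ⟩
    copair inr inl ∘ (inr ∘ b) ≈⟨ pullˡ copair₂ ⟩
    inl ∘ b                    ∎)

  -- The two pullback projections are, by construction, the restrictions of the isomorphism `φ` from
  -- the sum of the preimages onto `C`.
  preimages-epi : ∀ {A B C Z} (f : C ⇒ A +′ B) {a b : C ⇒ Z} →
                  a ∘ Pullback.p₁ (preimageˡ f) ≈ b ∘ Pullback.p₁ (preimageˡ f) →
                  a ∘ Pullback.p₁ (preimageʳ f) ≈ b ∘ Pullback.p₁ (preimageʳ f) → a ≈ b
  preimages-epi {A} {B} {C} f {a} {b} p q = begin
    a                ≈⟨ elimʳ invʳ ⟨
    a ∘ (φ ∘ _)      ≈⟨ pullˡ (copair-ext (Eq.trans assoc (Eq.trans p (Eq.sym assoc)))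
                                          (Eq.trans assoc (Eq.trans q (Eq.sym assoc)))) ⟩
    (b ∘ φ) ∘ _      ≈⟨ pullʳ invʳ ⟩
    b ∘ id           ≈⟨ idʳ ⟩
    b                ∎
    where
    open NaturalIso (IsEquivalenceOfCategories.FG (extensive A B))
    open IsIso (η-iso (C , f)) using (invʳ)
    φ = proj₁ (η (C , f))

-- Covering an expression by its monomials in the free distributive category

module FreeLemmas {a g} (G : DistributiveGraph a g) where
  open DistributiveGraph G
  open Free G hiding (𝓕; 𝓕-sums)
  open CategoryLemmas (𝓕 G)
  open Category.HomReasoning (𝓕 G)

  term : ∀ {x : Expr Object} → Monomial x → Expr Object
  term {atom v} _        = atom v
  term {𝟙}      _        = 𝟙
  term {s ⊕ t}  (inj₁ m) = term m
  term {s ⊕ t}  (inj₂ n) = term n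
  term {s ⊗ t}  (m , n)  = term m ⊗ term n

  incl : ∀ {x} (m : Monomial x) → term m ⟶ x
  incl {atom v} _        = idₜ
  incl {𝟙}      _        = idₜ
  incl {s ⊕ t}  (inj₁ m) = in₁ ∙ incl m
  incl {s ⊕ t}  (inj₂ n) = in₂ ∙ incl n
  incl {s ⊗ t}  (m , n)  = ⟨ incl m ∙ pr₁ , incl n ∙ pr₂ ⟩

  ⟨,⟩-∙ : ∀ {x y z w} {f : z ⟶ x} {h : z ⟶ y} {k : w ⟶ z} →
          ⟨ f , h ⟩ ∙ k ∼ ⟨ f ∙ k , h ∙ k ⟩
  ⟨,⟩-∙ = ⟨,⟩-η (pullˡ ⟨,⟩-β₁) (pullˡ ⟨,⟩-β₂)

  ⟨,⟩-resp : ∀ {x y z} {f f′ : z ⟶ x} {h h′ : z ⟶ y} → f ∼ f′ → h ∼ h′ → ⟨ f , h ⟩ ∼ ⟨ f′ , h′ ⟩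
  ⟨,⟩-resp p q = ⟨,⟩-η (∼trans ⟨,⟩-β₁ p) (∼trans ⟨,⟩-β₂ q)

  -- Closure under the covers that come from finite sums: the empty one and the pair of injections.
  -- `Q` may carry data, so that induction over a cover also constructs arrows.
  record IsSieve {q x} (Q : ∀ {z} → z ⟶ x → Set q) : Set (a ⊔ g ⊔ q) where
    field
      resp  : ∀ {z} {c d : z ⟶ x} → c ∼ d → Q c → Q d
      pre   : ∀ {z w} {c : z ⟶ x} (k : w ⟶ z) → Q c → Q (c ∙ k)
      empty : ∀ {z} (c : z ⟶ x) → z ⟶ 𝟘 → Q c
      glue  : ∀ {s t} {c : s ⊕ t ⟶ x} → Q (c ∙ in₁) → Q (c ∙ in₂) → Q c

  infix 8 _◁_
  _◁_ : ∀ w {x y} → x ⟶ y → w ⊗ x ⟶ w ⊗ y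
  w ◁ f = ⟨ idₜ ∙ pr₁ , f ∙ pr₂ ⟩

  ◁-∙ : ∀ {w x y z} {f : x ⟶ y} {h : y ⟶ z} → (w ◁ h) ∙ (w ◁ f) ∼ w ◁ (h ∙ f)
  ◁-∙ = ∼trans ⟨,⟩-∙ (⟨,⟩-resp (∼trans (pullʳ ⟨,⟩-β₁) ∙-idˡ)
                                (∼trans (pullʳ ⟨,⟩-β₂) (∼sym ∙-assoc)))

  ◁-id : ∀ {w x} → w ◁ idₜ {x} ∼ idₜ
  ◁-id = ∼sym (⟨,⟩-η (∼trans ∙-idʳ (∼sym ∙-idˡ)) (∼trans ∙-idʳ (∼sym ∙-idˡ)))

  assocˡ : ∀ {x y z} → (x ⊗ y) ⊗ z ⟶ x ⊗ (y ⊗ z)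
  assocˡ = ⟨ pr₁ ∙ pr₁ , ⟨ pr₂ ∙ pr₁ , pr₂ ⟩ ⟩

  assocʳ : ∀ {x y z} → x ⊗ (y ⊗ z) ⟶ (x ⊗ y) ⊗ z
  assocʳ = ⟨ ⟨ pr₁ , pr₁ ∙ pr₂ ⟩ , pr₂ ∙ pr₂ ⟩

  pair-assoc : ∀ {v x y z} {p : v ⟶ x} {q : v ⟶ y} {r : v ⟶ z} →
               assocˡ ∙ ⟨ ⟨ p , q ⟩ , r ⟩ ∼ ⟨ p , ⟨ q , r ⟩ ⟩
  pair-assoc = ∼trans ⟨,⟩-∙ (⟨,⟩-resp (∼trans (pullʳ ⟨,⟩-β₁) ⟨,⟩-β₁)
    (∼trans ⟨,⟩-∙ (⟨,⟩-resp (∼trans (pullʳ ⟨,⟩-β₁) ⟨,⟩-β₂) ⟨,⟩-β₂)))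

  assocˡʳ : ∀ {x y z} → assocˡ {x} {y} {z} ∙ assocʳ ∼ idₜ
  assocˡʳ = ∼trans pair-assoc (∼sym (⟨,⟩-η ∙-idʳ (∼trans ∙-idʳ (⟨,⟩-η ∼refl ∼refl))))

  exchange : ∀ {x y z} → (x ⊗ y) ⊗ z ⟶ (x ⊗ z) ⊗ y
  exchange = ⟨ ⟨ pr₁ ∙ pr₁ , pr₂ ⟩ , pr₂ ∙ pr₁ ⟩

  pair-exchange : ∀ {v x y z} {p : v ⟶ x} {q : v ⟶ y} {r : v ⟶ z} →
                  exchange ∙ ⟨ ⟨ p , q ⟩ , r ⟩ ∼ ⟨ ⟨ p , r ⟩ , q ⟩
  pair-exchange = ∼trans ⟨,⟩-∙ (⟨,⟩-resp
    (∼trans ⟨,⟩-∙ (⟨,⟩-resp (∼trans (pullʳ ⟨,⟩-β₁) ⟨,⟩-β₁) ⟨,⟩-β₂))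
    (∼trans (pullʳ ⟨,⟩-β₁) ⟨,⟩-β₂))

  exchange-involutive : ∀ {x y z} → exchange {x} {y} {z} ∙ exchange ∼ idₜ
  exchange-involutive =
    ∼trans pair-exchange (∼sym (⟨,⟩-η (∼trans ∙-idʳ (⟨,⟩-η ∼refl ∼refl)) ∙-idʳ))

  pair-◁ : ∀ {v w x y} {f : x ⟶ y} {p : v ⟶ w} {q : v ⟶ x} →
           (w ◁ f) ∙ ⟨ p , q ⟩ ∼ ⟨ p , f ∙ q ⟩
  pair-◁ = ∼trans ⟨,⟩-∙ (⟨,⟩-resp (∼trans (pullʳ ⟨,⟩-β₁) ∙-idˡ) (pullʳ ⟨,⟩-β₂))

  -- For the product case of `cover-◁`: restricting the second factor, exchanging, and then
  -- restricting the first amounts to restricting both at once, up to a rearrangement of the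
  -- factors.
  exchange-◁ : ∀ {w s t s′ t′} {f : s′ ⟶ s} {h : t′ ⟶ t} →
    assocˡ ∙ (((w ⊗ s) ◁ h) ∙ (exchange ∙ ((w ⊗ t′) ◁ f))) ∼
    (w ◁ ⟨ f ∙ pr₁ , h ∙ pr₂ ⟩) ∙ (assocˡ ∙ exchange)
  exchange-◁ {w} {s} {t} {s′} {t′} {f} {h} = begin
    assocˡ ∙ (((w ⊗ s) ◁ h) ∙ (exchange ∙ ((w ⊗ t′) ◁ f)))
      ≈⟨ ∙-resp ∼refl (∙-resp ∼refl (∙-resp ∼refl
           (⟨,⟩-resp (∼trans ∙-idˡ (⟨,⟩-η ∼refl ∼refl)) ∼refl))) ⟩
    assocˡ ∙ (((w ⊗ s) ◁ h) ∙ (exchange ∙ ⟨ ⟨ pr₁ ∙ pr₁ , pr₂ ∙ pr₁ ⟩ , f ∙ pr₂ ⟩))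
      ≈⟨ ∙-resp ∼refl (∙-resp ∼refl pair-exchange) ⟩
    assocˡ ∙ (((w ⊗ s) ◁ h) ∙ ⟨ ⟨ pr₁ ∙ pr₁ , f ∙ pr₂ ⟩ , pr₂ ∙ pr₁ ⟩)
      ≈⟨ ∙-resp ∼refl pair-◁ ⟩
    assocˡ ∙ ⟨ ⟨ pr₁ ∙ pr₁ , f ∙ pr₂ ⟩ , h ∙ (pr₂ ∙ pr₁) ⟩
      ≈⟨ pair-assoc ⟩
    ⟨ pr₁ ∙ pr₁ , ⟨ f ∙ pr₂ , h ∙ (pr₂ ∙ pr₁) ⟩ ⟩
      ≈⟨ ⟨,⟩-resp ∼refl (∼sym (∼trans ⟨,⟩-∙ (⟨,⟩-resp (pullʳ ⟨,⟩-β₁) (pullʳ ⟨,⟩-β₂)))) ⟩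
    ⟨ pr₁ ∙ pr₁ , ⟨ f ∙ pr₁ , h ∙ pr₂ ⟩ ∙ ⟨ pr₂ , pr₂ ∙ pr₁ ⟩ ⟩
      ≈⟨ pair-◁ ⟨
    (w ◁ ⟨ f ∙ pr₁ , h ∙ pr₂ ⟩) ∙ ⟨ pr₁ ∙ pr₁ , ⟨ pr₂ , pr₂ ∙ pr₁ ⟩ ⟩
      ≈⟨ ∙-resp ∼refl pair-assoc ⟨
    (w ◁ ⟨ f ∙ pr₁ , h ∙ pr₂ ⟩) ∙ (assocˡ ∙ exchange)
      ∎

  module _ {q x} {Q : ∀ {z} → z ⟶ x → Set q} (sieve : IsSieve Q) where
    open IsSieve sieve

    -- The factor w makes the claim strong enough for the induction through ⊗.
    cover-◁ : ∀ w v (c : w ⊗ v ⟶ x) → (∀ m → Q (c ∙ (w ◁ incl m))) → Q c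
    cover-◁ w (atom v) c p = resp (∼trans (∙-resp ∼refl ◁-id) ∙-idʳ) (p tt)
    cover-◁ w 𝟘        c p = empty c pr₂
    cover-◁ w 𝟙        c p = resp (∼trans (∙-resp ∼refl ◁-id) ∙-idʳ) (p tt)
    cover-◁ w (s ⊕ t)  c p = resp (∼trans (pullʳ distʳ) ∙-idʳ) (pre dist⁻¹ (glue
      (resp (∼sym (pullʳ [∣]-β₁))
        (cover-◁ w s (c ∙ (w ◁ in₁)) λ m → resp (∼sym (pullʳ ◁-∙)) (p (inj₁ m))))
      (resp (∼sym (pullʳ [∣]-β₂))
        (cover-◁ w t (c ∙ (w ◁ in₂)) λ n → resp (∼sym (pullʳ ◁-∙)) (p (inj₂ n))))))
    -- First `t` is covered with `w ⊗ s` held fixed; then `exchange` brings `s` to the end, and it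
    -- is covered with `w ⊗ term n` held fixed.
    cover-◁ w (s ⊗ t)  c p = resp (∼trans (pullʳ assocˡʳ) ∙-idʳ) (pre assocʳ
      (cover-◁ (w ⊗ s) t (c ∙ assocˡ) λ n →
        resp (∼trans (pullʳ exchange-involutive) ∙-idʳ) (pre exchange
          (cover-◁ (w ⊗ term n) s (((c ∙ assocˡ) ∙ ((w ⊗ s) ◁ incl n)) ∙ exchange) λ m →
            resp (∼trans ∙-assoc (∼trans (∙-resp ∼refl (∼sym exchange-◁))
                   (∼sym (∼trans ∙-assoc (∼trans ∙-assoc ∙-assoc)))))
              (pre (assocˡ ∙ exchange) (p (m , n)))))))

    cover : (∀ m → Q (incl m)) → Q idₜ
    -- The fixed factor is taken to be `𝟙`, and `⟨ ! , idₜ ⟩` is a section of the projection that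
    -- removes it.
    cover p = resp ⟨,⟩-β₂ (pre ⟨ ! , idₜ ⟩ (cover-◁ 𝟙 x pr₂ λ m →
      resp (∼sym ⟨,⟩-β₂) (pre pr₂ (p m))))

  -- The arrows into `y` whose domain maps to `𝟘` form a sieve. With no monomial to check, the
  -- identity belongs to it.
  no-monomials : ∀ {y} → ¬ Monomial y → y ⟶ 𝟘
  no-monomials none = cover
    (record
      { resp = λ _ k → k ; pre = λ k l → l ∙ k ; empty = λ _ k → k ; glue = [_∣_] })
    (λ m → contradiction m none)

  -- Inverse distributivity on summands and indicators of monomials

  dist⁻¹-in₁ : ∀ {w x y z} {p : z ⟶ w} {q : z ⟶ x} →
               dist⁻¹ ∙ ⟨ p , in₁ {x} {y} ∙ q ⟩ ∼ in₁ ∙ ⟨ p , q ⟩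
  dist⁻¹-in₁ {p = p} {q} = begin
    dist⁻¹ ∙ ⟨ p , in₁ ∙ q ⟩            ≈⟨ ∙-resp ∼refl (∼trans (pullˡ [∣]-β₁) pair-◁) ⟨
    dist⁻¹ ∙ (dist ∙ (in₁ ∙ ⟨ p , q ⟩)) ≈⟨ ∼trans (pullˡ distˡ) ∙-idˡ ⟩
    in₁ ∙ ⟨ p , q ⟩                     ∎

  dist⁻¹-in₂ : ∀ {w x y z} {p : z ⟶ w} {q : z ⟶ y} →
               dist⁻¹ ∙ ⟨ p , in₂ {x} {y} ∙ q ⟩ ∼ in₂ ∙ ⟨ p , q ⟩
  dist⁻¹-in₂ {p = p} {q} = begin
    dist⁻¹ ∙ ⟨ p , in₂ ∙ q ⟩            ≈⟨ ∙-resp ∼refl (∼trans (pullˡ [∣]-β₂) pair-◁) ⟨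
    dist⁻¹ ∙ (dist ∙ (in₂ ∙ ⟨ p , q ⟩)) ≈⟨ ∼trans (pullˡ distˡ) ∙-idˡ ⟩
    in₂ ∙ ⟨ p , q ⟩                     ∎

  -- Truth is `in₁` and falsity is `in₂`; the case distinction is on the second argument.
  conj : (𝟙 ⊕ 𝟙) ⊗ (𝟙 ⊕ 𝟙) ⟶ 𝟙 ⊕ 𝟙
  conj = [ pr₁ ∣ in₂ ∙ ! ] ∙ dist⁻¹

  conj-in₁ : ∀ {z} {p : z ⟶ 𝟙 ⊕ 𝟙} {q : z ⟶ 𝟙} → conj ∙ ⟨ p , in₁ ∙ q ⟩ ∼ p
  conj-in₁ = ∼trans (pullʳ dist⁻¹-in₁) (∼trans (pullˡ [∣]-β₁) ⟨,⟩-β₁)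

  conj-in₂ : ∀ {z} {p : z ⟶ 𝟙 ⊕ 𝟙} {q : z ⟶ 𝟙} → conj ∙ ⟨ p , in₂ ∙ q ⟩ ∼ in₂ ∙ !
  conj-in₂ = ∼trans (pullʳ dist⁻¹-in₂) (∼trans (pullˡ [∣]-β₂) (pullʳ !-uniq))

  -- The characteristic map of a monomial, used in `looping-empty` to separate it from the others by
  -- arrows of the free category.
  indicator : ∀ {x} → Monomial x → x ⟶ 𝟙 ⊕ 𝟙
  indicator {atom _} _        = in₁ ∙ !
  indicator {𝟙}      _        = in₁ ∙ !
  indicator {s ⊕ t}  (inj₁ m) = [ indicator m ∣ in₂ ∙ ! ]
  indicator {s ⊕ t}  (inj₂ n) = [ in₂ ∙ ! ∣ indicator n ]
  indicator {s ⊗ t}  (m , n)  = conj ∙ ⟨ indicator m ∙ pr₁ , indicator n ∙ pr₂ ⟩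

  private
    indicator-⊗ : ∀ {s t} (m m′ : Monomial s) (n n′ : Monomial t) {j k} →
      indicator m ∙ incl m′ ∼ j → indicator n ∙ incl n′ ∼ k →
      indicator (m , n) ∙ incl (m′ , n′) ∼ conj ∙ ⟨ j ∙ pr₁ , k ∙ pr₂ ⟩
    indicator-⊗ m m′ n n′ p q = pullʳ (∼trans ⟨,⟩-∙ (⟨,⟩-resp
      (∼trans (pullʳ ⟨,⟩-β₁) (pullˡ p)) (∼trans (pullʳ ⟨,⟩-β₂) (pullˡ q))))

  indicator-same : ∀ {x} (m : Monomial x) → indicator m ∙ incl m ∼ in₁ ∙ !
  indicator-same {atom _} _        = ∙-idʳ
  indicator-same {𝟙}      _        = ∙-idʳ
  indicator-same {s ⊕ t}  (inj₁ m) = ∼trans (pullˡ [∣]-β₁) (indicator-same m)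
  indicator-same {s ⊕ t}  (inj₂ n) = ∼trans (pullˡ [∣]-β₂) (indicator-same n)
  indicator-same {s ⊗ t}  (m , n)  =
    ∼trans (indicator-⊗ m m n n (indicator-same m) (indicator-same n))
      (∼trans (∙-resp ∼refl (⟨,⟩-resp ∼refl ∙-assoc)) (∼trans conj-in₁ (pullʳ !-uniq)))

  indicator-other : ∀ {x} (m m′ : Monomial x) → m′ ≡ m ⊎ indicator m ∙ incl m′ ∼ in₂ ∙ !
  indicator-other {atom _} _ _ = inj₁ ≡.refl
  indicator-other {𝟙}      _ _ = inj₁ ≡.refl
  indicator-other {s ⊕ t} (inj₁ m) (inj₁ m′) with indicator-other m m′
  ... | inj₁ eq = inj₁ (≡.cong inj₁ eq)
  ... | inj₂ p  = inj₂ (∼trans (pullˡ [∣]-β₁) p)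
  indicator-other {s ⊕ t} (inj₁ m) (inj₂ n′) = inj₂ (∼trans (pullˡ [∣]-β₂) (pullʳ !-uniq))
  indicator-other {s ⊕ t} (inj₂ n) (inj₁ m′) = inj₂ (∼trans (pullˡ [∣]-β₁) (pullʳ !-uniq))
  indicator-other {s ⊕ t} (inj₂ n) (inj₂ n′) with indicator-other n n′
  ... | inj₁ eq = inj₁ (≡.cong inj₂ eq)
  ... | inj₂ p  = inj₂ (∼trans (pullˡ [∣]-β₂) p)
  indicator-other {s ⊗ t} (m , n) (m′ , n′) with indicator-other m m′ | indicator-other n n′
  ... | inj₁ ≡.refl | inj₁ ≡.refl = inj₁ ≡.refl
  -- A false second argument settles `conj` at once; if the second positions agree, that argument is
  -- true and the first one decides.
  ... | _           | inj₂ q      = inj₂ (∼trans (indicator-⊗ m m′ n n′ ∼refl q)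
    (∼trans (∙-resp ∼refl (⟨,⟩-resp ∼refl ∙-assoc)) conj-in₂))
  ... | inj₂ p      | inj₁ ≡.refl = inj₂ (∼trans (indicator-⊗ m m′ n n p (indicator-same n))
    (∼trans (∙-resp ∼refl (⟨,⟩-resp ∼refl ∙-assoc)) (∼trans conj-in₁ (pullʳ !-uniq))))

-- Action of the image on monomials

module ImageLemmas {a g o ℓ e} {G : DistributiveGraph a g} {E : Category o ℓ e}
                   (ext : IsExtensive E) (S : DistributiveFunctor (𝓕 G) E) where
  open DistributiveGraph G
  open DistributiveFunctor S
  open Category E
  open CategoryLemmas E
  open ExtensiveLemmas ext
  open IsExtensive ext
  open FiniteSums sums renaming (_+_ to _+′_)
  open Preimage ext
  open HomReasoning
  open Free G hiding (𝓕; 𝓕-sums)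
  open FreeLemmas G

  F-sum : ∀ {s t} → IsCoproduct E (F₁ (in₁ {s} {t})) (F₁ in₂)
  F-sum = preserves-coproduct (FiniteSums.+-sum (𝓕-sums G))

  F-product : ∀ {s t} → IsProduct E (F₁ (pr₁ {s} {t})) (F₁ pr₂)
  F-product = preserves-product (FiniteProducts.×-product 𝓕-products)

  F-initial : IsInitial E (F₀ 𝟘)
  F-initial = preserves-initial (FiniteSums.𝟎-initial (𝓕-sums G))

  from-F𝟘 : F₀ 𝟘 ⇒ 𝟎
  from-F𝟘 = IsInitial.initial F-initial

  F-resp-∙ : ∀ {x y z} {f : y ⟶ z} {h : x ⟶ y} {k : x ⟶ z} → f ∙ h ∼ k → F₁ f ∘ F₁ h ≈ F₁ k
  F-resp-∙ p = Eq.trans (Eq.sym F-∘) (F-resp p)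

  -- Local on Q: sums in E are stable under pullback, so distributivity is not involved.
  incl-epi : ∀ v {Q Z} (p : Q ⇒ F₀ v) {h k : Q ⇒ Z} →
             (∀ (m : Monomial v) {R} (q : R ⇒ Q) (r : R ⇒ F₀ (term m)) →
                p ∘ q ≈ F₁ (incl m) ∘ r → h ∘ q ≈ k ∘ q) →
             h ≈ k
  incl-epi (atom _) p eq = Eq.trans (Eq.sym idʳ) (Eq.trans
    (eq tt id p (Eq.trans idʳ (Eq.sym (elimˡ F-id)))) idʳ)
  incl-epi 𝟘 p eq = strict (from-F𝟘 ∘ p)
  incl-epi 𝟙 p eq = Eq.trans (Eq.sym idʳ) (Eq.trans
    (eq tt id p (Eq.trans idʳ (Eq.sym (elimˡ F-id)))) idʳ)
  incl-epi (s ⊕ t) {Q} p eq = preimages-epi p′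
    (incl-epi s (Pullback.p₂ pbˡ) λ m q r c →
      Eq.trans assoc (Eq.trans (eq (inj₁ m) (Pullback.p₁ pbˡ ∘ q) r (begin
        p ∘ (Pullback.p₁ pbˡ ∘ q)          ≈⟨ pullˡ (restrict (Pullback.commute pbˡ) copair₁) ⟩
        (F₁ in₁ ∘ Pullback.p₂ pbˡ) ∘ q     ≈⟨ pullʳ c ⟩
        F₁ in₁ ∘ (F₁ (incl m) ∘ r)         ≈⟨ pullˡ (F-resp-∙ ∼refl) ⟩
        F₁ (in₁ ∙ incl m) ∘ r              ∎)) (Eq.sym assoc)))
    (incl-epi t (Pullback.p₂ pbʳ) λ n q r c →
      Eq.trans assoc (Eq.trans (eq (inj₂ n) (Pullback.p₁ pbʳ ∘ q) r (begin
        p ∘ (Pullback.p₁ pbʳ ∘ q)          ≈⟨ pullˡ (restrict (Pullback.commute pbʳ) copair₂) ⟩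
        (F₁ in₂ ∘ Pullback.p₂ pbʳ) ∘ q     ≈⟨ pullʳ c ⟩
        F₁ in₂ ∘ (F₁ (incl n) ∘ r)         ≈⟨ pullˡ (F-resp-∙ ∼refl) ⟩
        F₁ (in₂ ∙ incl n) ∘ r              ∎)) (Eq.sym assoc)))
    where
    back : F₀ s +′ F₀ t ⇒ F₀ (s ⊕ t)
    back = copair (F₁ in₁) (F₁ in₂)
    forth : F₀ (s ⊕ t) ⇒ F₀ s +′ F₀ t
    forth = IsCoproduct.copair F-sum inl inr
    p′ : Q ⇒ F₀ s +′ F₀ t
    p′ = forth ∘ p
    pbˡ = preimageˡ p′
    pbʳ = preimageʳ p′
    back-forth : back ∘ forth ≈ id
    back-forth = IsCoproduct-ext F-sum
      (Eq.trans (pullʳ (IsCoproduct.copair₁ F-sum)) (Eq.trans copair₁ (Eq.sym idˡ)))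
      (Eq.trans (pullʳ (IsCoproduct.copair₂ F-sum)) (Eq.trans copair₂ (Eq.sym idˡ)))
    restrict : ∀ {R V} {q : R ⇒ Q} {i : V ⇒ F₀ s +′ F₀ t} {r : R ⇒ V} {j : V ⇒ F₀ (s ⊕ t)} →
               p′ ∘ q ≈ i ∘ r → back ∘ i ≈ j → p ∘ q ≈ j ∘ r
    restrict {q = q} {i} {r} {j} c d = begin
      p ∘ q                   ≈⟨ elimˡ back-forth ⟨
      (back ∘ forth) ∘ p ∘ q  ≈⟨ pullʳ (Eq.trans (Eq.sym assoc) c) ⟩
      back ∘ (i ∘ r)          ≈⟨ pullˡ d ⟩
      j ∘ r                   ∎
  -- Each piece of `Q` over a monomial of `s` is cut again over the monomials of `t`; the two lifts
  -- pair to a lift through the product.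
  incl-epi (s ⊗ t) p eq =
    incl-epi s (F₁ pr₁ ∘ p) λ m q r c →
      incl-epi t (F₁ pr₂ ∘ (p ∘ q)) λ n q′ r′ c′ →
        Eq.trans assoc (Eq.trans
          (eq (m , n) (q ∘ q′) (IsProduct.pair F-product (r ∘ q′) r′)
            (IsProduct-ext F-product
              (begin
                F₁ pr₁ ∘ (p ∘ (q ∘ q′))  ≈⟨ Eq.trans (Eq.sym assoc) (Eq.sym assoc) ⟩
                ((F₁ pr₁ ∘ p) ∘ q) ∘ q′  ≈⟨ ∘-congʳ c ⟩
                (F₁ (incl m) ∘ r) ∘ q′   ≈⟨ pullʳ (Eq.sym (IsProduct.pair₁ F-product)) ⟩
                F₁ (incl m) ∘ (F₁ pr₁ ∘ IsProduct.pair F-product (r ∘ q′) r′)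
                  ≈⟨ Eq.trans (Eq.sym assoc) (∘-congʳ (Eq.sym F-∘)) ⟩
                F₁ (incl m ∙ pr₁) ∘ _    ≈⟨ pullˡ (F-resp-∙ ⟨,⟩-β₁) ⟨
                F₁ pr₁ ∘ (F₁ (incl (m , n)) ∘ _) ∎)
              (begin
                F₁ pr₂ ∘ (p ∘ (q ∘ q′))  ≈⟨ Eq.trans (∘-congˡ (Eq.sym assoc)) (Eq.sym assoc) ⟩
                (F₁ pr₂ ∘ (p ∘ q)) ∘ q′  ≈⟨ c′ ⟩
                F₁ (incl n) ∘ r′         ≈⟨ ∘-congˡ (Eq.sym (IsProduct.pair₂ F-product)) ⟩
                F₁ (incl n) ∘ (F₁ pr₂ ∘ IsProduct.pair F-product (r ∘ q′) r′)
                  ≈⟨ Eq.trans (Eq.sym assoc) (∘-congʳ (Eq.sym F-∘)) ⟩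
                F₁ (incl n ∙ pr₂) ∘ _    ≈⟨ pullˡ (F-resp-∙ ⟨,⟩-β₂) ⟨
                F₁ pr₂ ∘ (F₁ (incl (m , n)) ∘ _) ∎)))
          (Eq.sym assoc))

  -- κ is an arrow of 𝓕 G, not just an element of InImage, because the latter need not be
  -- closed under pairing.
  Restricts : ∀ {x y} → F₀ x ⇒ F₀ y → Monomial x → Set (a ⊔ g ⊔ ℓ ⊔ e)
  Restricts {x} {y} h m = (F₀ (term m) ⇒ 𝟎) ⊎
    (Σ[ n ∈ Monomial y ] Σ[ κ ∈ term m ⟶ term n ] h ∘ F₁ (incl m) ≈ F₁ (incl n ∙ κ))

  restrict-∘ : ∀ {x y z} {k : F₀ y ⇒ F₀ z} {h : F₀ x ⇒ F₀ y} {l : F₀ x ⇒ F₀ z} → l ≈ k ∘ h →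
               (∀ n → Restricts {y} {z} k n) → ∀ m → Restricts {x} {y} h m → Restricts {x} {z} l m
  restrict-∘ _ rk m (inj₁ z) = inj₁ z
  restrict-∘ {k = k} {h} {l} eq rk m (inj₂ (n , κ , p)) with rk n
  ... | inj₁ z = inj₁ (z ∘ F₁ κ)
  ... | inj₂ (n′ , κ′ , p′) = inj₂ (n′ , κ′ ∙ κ , (begin
    l ∘ F₁ (incl m)            ≈⟨ Eq.trans (∘-congʳ eq) (pullʳ p) ⟩
    k ∘ F₁ (incl n ∙ κ)        ≈⟨ Eq.trans (∘-congˡ F-∘) (pullˡ p′) ⟩
    F₁ (incl n′ ∙ κ′) ∘ F₁ κ   ≈⟨ F-resp-∙ ∙-assoc ⟩
    F₁ (incl n′ ∙ (κ′ ∙ κ))    ∎))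

  -- The arrows into `y` whose image under `S` factors through `incl n`, by an arrow of the free
  -- category, form a sieve containing the only monomial inclusion. The equation is stated in `E`,
  -- where strictness of the initial object settles the empty case.
  only-monomial : ∀ {y} (n : Monomial y) → (∀ m → m ≡ n) →
                  Σ[ κ ∈ y ⟶ term n ] F₁ (idₜ {y}) ≈ F₁ (incl n ∙ κ)
  only-monomial {y} n unique = cover sieve λ m → on-incl m (unique m)
    where
    Q : ∀ {z} → z ⟶ y → Set _
    Q {z} c = Σ[ κ ∈ z ⟶ term n ] F₁ c ≈ F₁ (incl n ∙ κ)
    sieve : IsSieve Q
    sieve = record
      { resp  = λ p (κ , q) → κ , Eq.trans (F-resp (∼sym p)) q
      ; pre   = λ k (κ , q) → κ ∙ k , Eq.trans F-∘ (Eq.trans (∘-congʳ q) (F-resp-∙ ∙-assoc))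
      ; empty = λ c k → ¡ ∙ k , strict (from-F𝟘 ∘ F₁ k)
      ; glue  = λ (κ , q) (κ′ , q′) → [ κ ∣ κ′ ] , IsCoproduct-ext F-sum
          (Eq.trans (Eq.sym F-∘) (Eq.trans q
            (Eq.sym (F-resp-∙ (∼trans ∙-assoc (∙-resp ∼refl [∣]-β₁))))))
          (Eq.trans (Eq.sym F-∘) (Eq.trans q′
            (Eq.sym (F-resp-∙ (∼trans ∙-assoc (∙-resp ∼refl [∣]-β₂))))))
      }
    on-incl : ∀ m → m ≡ n → Q (incl m)
    on-incl m ≡.refl = idₜ , F-resp (∼sym ∙-idʳ)

  module _ (no-control : ∀ {x y} (t : Arc x y) → ¬ IsControlFunction t) where

    -- Induction on the arrow. The structural arrows move each monomial to a single monomial by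
    -- themselves. An arc does so because its target has at most one monomial: with none, the source
    -- monomial becomes initial in `E`; with one, the target is retrieved from it by
    -- `only-monomial`.
    F₁-restricts : ∀ {x y} (f : x ⟶ y) m → Restricts {x} {y} (F₁ f) m
    F₁-restricts {x} {y} (arc t) m with none-or-one y (no-control t)
    ... | inj₁ none         = inj₁ (from-F𝟘 ∘ F₁ (no-monomials none ∙ (arc t ∙ incl m)))
    ... | inj₂ (n , unique) with only-monomial n unique
    ...   | κ , p = inj₂ (n , κ ∙ (arc t ∙ incl m) , (begin
      F₁ (arc t) ∘ F₁ (incl m)               ≈⟨ F-∘ ⟨
      F₁ (arc t ∙ incl m)                    ≈⟨ elimˡ F-id ⟨
      F₁ idₜ ∘ F₁ (arc t ∙ incl m)           ≈⟨ ∘-congʳ p ⟩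
      F₁ (incl n ∙ κ) ∘ F₁ (arc t ∙ incl m)  ≈⟨ F-resp-∙ ∙-assoc ⟩
      F₁ (incl n ∙ (κ ∙ (arc t ∙ incl m)))   ∎))
    F₁-restricts idₜ m = inj₂ (m , idₜ , F-resp-∙ (∼trans ∙-idˡ (∼sym ∙-idʳ)))
    F₁-restricts (f ∙ h) m = restrict-∘ F-∘ (F₁-restricts f) m (F₁-restricts h m)
    F₁-restricts ! m = inj₂ (tt , ! , F-resp-∙ (∼trans !-uniq (∼sym !-uniq)))
    F₁-restricts in₁ m = inj₂ (inj₁ m , idₜ , F-resp-∙ (∼sym ∙-idʳ))
    F₁-restricts in₂ m = inj₂ (inj₂ m , idₜ , F-resp-∙ (∼sym ∙-idʳ))
    F₁-restricts [ f ∣ h ] (inj₁ m) with F₁-restricts f m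
    ... | inj₁ z           = inj₁ z
    ... | inj₂ (n , κ , p) =
      inj₂ (n , κ , Eq.trans (Eq.trans
        (F-resp-∙ (∼trans (∼sym ∙-assoc) (∙-resp [∣]-β₁ ∼refl))) F-∘) p)
    F₁-restricts [ f ∣ h ] (inj₂ m) with F₁-restricts h m
    ... | inj₁ z           = inj₁ z
    ... | inj₂ (n , κ , p) =
      inj₂ (n , κ , Eq.trans (Eq.trans
        (F-resp-∙ (∼trans (∼sym ∙-assoc) (∙-resp [∣]-β₂ ∼refl))) F-∘) p)
    F₁-restricts pr₁ (m , n) = inj₂ (m , pr₁ , F-resp-∙ ⟨,⟩-β₁)
    F₁-restricts pr₂ (m , n) = inj₂ (n , pr₂ , F-resp-∙ ⟨,⟩-β₂)
    F₁-restricts ⟨ f , h ⟩ m with F₁-restricts f m | F₁-restricts h m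
    ... | inj₁ z           | _                  = inj₁ z
    ... | inj₂ _           | inj₁ z             = inj₁ z
    ... | inj₂ (n , κ , p) | inj₂ (n′ , κ′ , p′) =
      inj₂ ((n , n′) , ⟨ κ , κ′ ⟩ , IsProduct-ext F-product
        (begin
          F₁ pr₁ ∘ (F₁ ⟨ f , h ⟩ ∘ F₁ (incl m))   ≈⟨ pullˡ (F-resp-∙ ⟨,⟩-β₁) ⟩
          F₁ f ∘ F₁ (incl m)                      ≈⟨ p ⟩
          F₁ (incl n ∙ κ)                         ≈⟨ F-resp-∙ (via ⟨,⟩-β₁ ⟨,⟩-β₁) ⟨
          F₁ pr₁ ∘ F₁ (incl (n , n′) ∙ ⟨ κ , κ′ ⟩) ∎)
        (begin
          F₁ pr₂ ∘ (F₁ ⟨ f , h ⟩ ∘ F₁ (incl m))   ≈⟨ pullˡ (F-resp-∙ ⟨,⟩-β₂) ⟩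
          F₁ h ∘ F₁ (incl m)                      ≈⟨ p′ ⟩
          F₁ (incl n′ ∙ κ′)                       ≈⟨ F-resp-∙ (via ⟨,⟩-β₂ ⟨,⟩-β₂) ⟨
          F₁ pr₂ ∘ F₁ (incl (n , n′) ∙ ⟨ κ , κ′ ⟩) ∎))
      where
      via : ∀ {v w y z b} {p : y ⟶ z} {c : w ⟶ y} {i : b ⟶ z} {r : w ⟶ b} {l : v ⟶ w}
            {j : v ⟶ b} → p ∙ c ∼ i ∙ r → r ∙ l ∼ j → p ∙ (c ∙ l) ∼ i ∙ j
      via c d = ∼trans (CategoryLemmas.pullˡ (𝓕 G) c) (∼trans ∙-assoc (∙-resp ∼refl d))
    F₁-restricts dist⁻¹ (m , inj₁ n) = inj₂ (inj₁ (m , n) , idₜ , F-resp-∙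
      (∼trans (∙-resp ∼refl (⟨,⟩-resp ∼refl ∙-assoc)) (∼trans dist⁻¹-in₁ (∼sym ∙-idʳ))))
    F₁-restricts dist⁻¹ (m , inj₂ n) = inj₂ (inj₂ (m , n) , idₜ , F-resp-∙
      (∼trans (∙-resp ∼refl (⟨,⟩-resp ∼refl ∙-assoc)) (∼trans dist⁻¹-in₂ (∼sym ∙-idʳ))))

    restricts : ∀ {x y} {h : F₀ x ⇒ F₀ y} → InImage S {x} {y} h → ∀ m → Restricts {x} {y} h m
    restricts (image f eq) m with F₁-restricts f m
    ... | inj₁ z           = inj₁ z
    ... | inj₂ (n , κ , p) = inj₂ (n , κ , Eq.trans (∘-congʳ eq) p)
    restricts (fromInitial init _) m = inj₁ (IsInitial.initial init ∘ F₁ (incl m))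
    restricts (onSummands h p q) (inj₁ m) with restricts p m
    ... | inj₁ z           = inj₁ z
    ... | inj₂ (n , κ , c) = inj₂ (n , κ , Eq.trans (Eq.trans (∘-congˡ F-∘) (Eq.sym assoc)) c)
    restricts (onSummands h p q) (inj₂ m) with restricts q m
    ... | inj₁ z           = inj₁ z
    ... | inj₂ (n , κ , c) = inj₂ (n , κ , Eq.trans (Eq.trans (∘-congˡ F-∘) (Eq.sym assoc)) c)
    restricts (compose eq k h) m = restrict-∘ eq (restricts k) m (restricts h m)

  InImage-resp : ∀ {x y} {f h : F₀ x ⇒ F₀ y} → f ≈ h → InImage S {x} {y} f → InImage S {x} {y} h
  InImage-resp {x} {y} = SubcategoryWithSums.resp∈ (Image S) {x} {y}

  -- The arrows along which `h` restricts to a member form a sieve: the empty cover is handled by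
  -- `fromInitial` and binary sums by `onSummands`.
  InImage-cover : ∀ {x y} (h : F₀ x ⇒ F₀ y) →
                  (∀ m → InImage S {term m} {y} (h ∘ F₁ (incl m))) → InImage S {x} {y} h
  InImage-cover {x} {y} h p = InImage-resp (elimʳ F-id) (cover
    {Q = λ {z} c → InImage S {z} {y} (h ∘ F₁ c)}
    (record
      { resp  = λ c → InImage-resp (∘-congˡ (F-resp c))
      ; pre   = λ k m → compose (Eq.trans (∘-congˡ F-∘) (Eq.sym assoc)) m (image k Eq.refl)
      ; empty = λ c k → fromInitial (strict-initial (from-F𝟘 ∘ F₁ k)) _
      ; glue  = λ p q → onSummands _ (InImage-resp (Eq.trans (∘-congˡ F-∘) (Eq.sym assoc)) p)
                                     (InImage-resp (Eq.trans (∘-congˡ F-∘) (Eq.sym assoc)) q)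
      })
    p)

-- Domains and exit domains of an iteration

module CallLemmas {a g o ℓ e} {G : DistributiveGraph a g} {E : Category o ℓ e}
                  (ext : IsExtensive E) (S : DistributiveFunctor (𝓕 G) E) where
  open DistributiveGraph G
  open DistributiveFunctor S
  open Category E
  open CategoryLemmas E
  open ExtensiveLemmas ext
  open IsExtensive ext
  open FiniteSums sums renaming (_+_ to _+′_)
  open Preimage ext
  open Iteration ext
  open HomReasoning
  open Free G hiding (𝓕; 𝓕-sums)
  open FreeLemmas G
  open ImageLemmas ext S

  module _ {X U Y} (f : X +′ U ⇒ U +′ Y) where

    -- Each passage from `dom f (suc k)` to `dom f k` is a pullback of the monomorphism `inl`.
    dom-inj-mono : ∀ k {Q} {u v : Q ⇒ dom f k} → dom-inj f k ∘ u ≈ dom-inj f k ∘ v → u ≈ v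
    dom-inj-mono zero    p = Eq.trans (Eq.sym idˡ) (Eq.trans p idˡ)
    dom-inj-mono (suc k) {u = u} {v} p = Pullback.unique pb p₁-eq (inl-mono (begin
      inl ∘ (Pullback.p₂ pb ∘ u)         ≈⟨ pullˡ (Eq.sym (Pullback.commute pb)) ⟩
      (iterate f k ∘ Pullback.p₁ pb) ∘ u ≈⟨ pullʳ p₁-eq ⟩
      iterate f k ∘ (Pullback.p₁ pb ∘ v) ≈⟨ pullˡ (Pullback.commute pb) ⟩
      (inl ∘ Pullback.p₂ pb) ∘ v         ≈⟨ assoc ⟩
      inl ∘ (Pullback.p₂ pb ∘ v)         ∎))
      where
      pb = preimageˡ (iterate f k)
      p₁-eq = dom-inj-mono k (Eq.trans (Eq.sym assoc) (Eq.trans p assoc))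

    -- As `dom-inj f k` is mono, the two arrows already agree in `dom f k`. There the iterate lands
    -- in `U` along one of them and in `Y` along the other, and these summands are disjoint.
    exit-disjoint : ∀ k {Q V} {d : V ⇒ dom f k} {v : V ⇒ U} {q : Q ⇒ exit f k} {r : Q ⇒ V} →
                    iterate f k ∘ d ≈ inl ∘ v →
                    exit-inj f k ∘ q ≈ dom-inj f k ∘ (d ∘ r) → Q ⇒ 𝟎
    exit-disjoint k {d = d} {v} {q} {r} stays meet = disjoint (begin
      inl ∘ (v ∘ r)                      ≈⟨ pullˡ (Eq.sym stays) ⟩
      (iterate f k ∘ d) ∘ r              ≈⟨ pullʳ (Eq.sym same) ⟩
      iterate f k ∘ (Pullback.p₁ pb ∘ q) ≈⟨ pullˡ (Pullback.commute pb) ⟩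
      (inr ∘ Pullback.p₂ pb) ∘ q         ≈⟨ assoc ⟩
      inr ∘ (Pullback.p₂ pb ∘ q)         ∎)
      where
      pb = preimageʳ (iterate f k)
      same = dom-inj-mono k (Eq.trans (Eq.sym assoc) meet)

  module _ {x U Y} (f : F₀ x +′ U ⇒ U +′ Y) (terminates : Terminates f) where

    -- The two test maps into 1 + 1 differ only on the monomial m, which no exit
    -- domain meets; E itself is not assumed to have a terminal object, but S 𝟙 is one.
    looping-empty : ∀ (m : Monomial x) →
      (∀ k → Σ[ d ∈ F₀ (term m) ⇒ dom f k ] Σ[ v ∈ F₀ (term m) ⇒ U ]
         dom-inj f k ∘ d ≈ F₁ (incl m) × iterate f k ∘ d ≈ inl ∘ v) →
      F₀ (term m) ⇒ 𝟎
    looping-empty m loops = disjoint (begin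
      inl ∘ F₁ !                             ≈⟨ pullˡ (IsCoproduct.copair₁ F-sum) ⟨
      forth ∘ (F₁ in₁ ∘ F₁ !)                ≈⟨ ∘-congˡ (Eq.sym F-∘) ⟩
      forth ∘ F₁ (in₁ ∙ !)                   ≈⟨ ∘-congˡ (F-resp (indicator-same m)) ⟨
      forth ∘ F₁ (indicator m ∙ incl m)      ≈⟨ ∘-congˡ F-∘ ⟩
      forth ∘ (F₁ (indicator m) ∘ F₁ (incl m)) ≈⟨ ∘-congˡ (∘-congʳ same) ⟩
      forth ∘ (F₁ (in₂ ∙ !) ∘ F₁ (incl m))   ≈⟨ ∘-congˡ (F-resp-∙ in₂!) ⟩
      forth ∘ F₁ (in₂ ∙ !)                   ≈⟨ ∘-congˡ F-∘ ⟩
      forth ∘ (F₁ in₂ ∘ F₁ !)                ≈⟨ pullˡ (IsCoproduct.copair₂ F-sum) ⟩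
      inr ∘ F₁ !                             ∎)
      where
      forth : F₀ (𝟙 ⊕ 𝟙) ⇒ F₀ 𝟙 +′ F₀ 𝟙
      forth = IsCoproduct.copair F-sum inl inr
      in₂! : ∀ {z w} {k : z ⟶ w} → (in₂ {𝟙} ∙ !) ∙ k ∼ in₂ ∙ !
      in₂! = ∼trans ∙-assoc (∙-resp ∼refl !-uniq)
      same-on-exit : ∀ k → F₁ (in₂ ∙ !) ∘ exit-inj f k ≈ F₁ (indicator m) ∘ exit-inj f k
      same-on-exit k = incl-epi x (exit-inj f k) compare
        where
        compare : ∀ m′ {R} (q : R ⇒ exit f k) (r : R ⇒ F₀ (term m′)) →
                  exit-inj f k ∘ q ≈ F₁ (incl m′) ∘ r →
                  (F₁ (in₂ ∙ !) ∘ exit-inj f k) ∘ q ≈ (F₁ (indicator m) ∘ exit-inj f k) ∘ q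
        compare m′ q r meet with indicator-other m m′
        -- Over `m` itself a piece of the exit domain both stays in `U` and leaves to `Y` at step
        -- `k`, so it is initial and any two maps out of it agree.
        ... | inj₁ ≡.refl = let d , v , over , stays = loops k in
          strict (exit-disjoint f k stays (Eq.trans meet (Eq.trans (∘-congʳ (Eq.sym over)) assoc)))
        ... | inj₂ p = begin
          (F₁ (in₂ ∙ !) ∘ exit-inj f k) ∘ q       ≈⟨ pullʳ meet ⟩
          F₁ (in₂ ∙ !) ∘ (F₁ (incl m′) ∘ r)       ≈⟨ pullˡ (F-resp-∙ in₂!) ⟩
          F₁ (in₂ ∙ !) ∘ r                        ≈⟨ pullˡ (F-resp-∙ p) ⟨
          F₁ (indicator m) ∘ (F₁ (incl m′) ∘ r)   ≈⟨ pullʳ meet ⟨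
          (F₁ (indicator m) ∘ exit-inj f k) ∘ q   ∎
      same : F₁ (indicator m) ≈ F₁ (in₂ ∙ !)
      -- Termination makes `F₀ x` the sum of the exit domains, so agreement on each of them
      -- suffices.
      same = Eq.trans (IsSum.cotuple! terminates λ _ → Eq.refl)
        (Eq.sym (IsSum.cotuple! terminates same-on-exit))

  -- Runs of the automaton on monomials

  module _ {x u y} (f : F₀ (x ⊕ u) ⇒ F₀ (u ⊕ y)) where

    private
      f′ : F₀ x +′ F₀ u ⇒ F₀ u +′ F₀ y
      f′ = onSums ext (Image S) {x} {u} {y} f
      forth : F₀ (u ⊕ y) ⇒ F₀ u +′ F₀ y
      forth = IsCoproduct.copair F-sum inl inr

    data Outcome {z} (h : F₀ z ⇒ F₀ u +′ F₀ y) : Set (a ⊔ g ⊔ ℓ ⊔ e) where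
      vanish : F₀ z ⇒ 𝟎 → Outcome h
      stay   : ∀ n (κ : z ⟶ term n) → h ≈ inl ∘ F₁ (incl n ∙ κ) → Outcome h
      leave  : ∀ n (κ : z ⟶ term n) → h ≈ inr ∘ F₁ (incl n ∙ κ) → Outcome h

    -- The transition of the automaton, whose states are the monomials of `u`. Vanishing and leaving
    -- both stop the run; `settle` tells them apart.
    next : ∀ {z} {h : F₀ z ⇒ F₀ u +′ F₀ y} → Outcome {z} h → Maybe (Monomial u)
    next (stay n _ _) = just n
    next _            = nothing

    outcome : ∀ {z} {w : z ⟶ x ⊕ u} {h : F₀ z ⇒ F₀ u +′ F₀ y} → h ≈ forth ∘ (f ∘ F₁ w) →
              (F₀ z ⇒ 𝟎) ⊎ (Σ[ n ∈ Monomial (u ⊕ y) ] Σ[ κ ∈ z ⟶ term n ]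
                               f ∘ F₁ w ≈ F₁ (incl n ∙ κ)) →
              Outcome {z} h
    outcome eq (inj₁ z) = vanish z
    outcome eq (inj₂ (inj₁ n , κ , p)) = stay n κ (Eq.trans eq (Eq.trans (∘-congˡ
      (Eq.trans p (Eq.trans (F-resp ∙-assoc) F-∘))) (pullˡ (IsCoproduct.copair₁ F-sum))))
    outcome eq (inj₂ (inj₂ n , κ , p)) = leave n κ (Eq.trans eq (Eq.trans (∘-congˡ
      (Eq.trans p (Eq.trans (F-resp ∙-assoc) F-∘))) (pullˡ (IsCoproduct.copair₂ F-sum))))

    module Run (f-restricts : ∀ m → Restricts {x ⊕ u} {u ⊕ y} f m)
               (terminates : Terminates f′) where

      launch : ∀ m → Outcome {term m} ((f′ ∘ inl) ∘ F₁ (incl m))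
      launch m = outcome {term m} {in₁ ∙ incl m} (begin
        (f′ ∘ inl) ∘ F₁ (incl m)                  ≈⟨ ∘-congʳ (pullʳ (pullʳ copair₁)) ⟩
        (forth ∘ f ∘ F₁ in₁) ∘ F₁ (incl m)        ≈⟨ pullʳ (pullʳ (Eq.sym F-∘)) ⟩
        forth ∘ (f ∘ F₁ (in₁ ∙ incl m))           ∎) (f-restricts (inj₁ m))

      resume : ∀ n → Outcome {term n} ((f′ ∘ inr) ∘ F₁ (incl n))
      resume n = outcome {term n} {in₂ ∙ incl n} (begin
        (f′ ∘ inr) ∘ F₁ (incl n)                  ≈⟨ ∘-congʳ (pullʳ (pullʳ copair₂)) ⟩
        (forth ∘ f ∘ F₁ in₂) ∘ F₁ (incl n)        ≈⟨ pullʳ (pullʳ (Eq.sym F-∘)) ⟩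
        forth ∘ (f ∘ F₁ (in₂ ∙ incl n))           ∎) (f-restricts (inj₂ n))

      open Orbit (monomial-count u) (λ n → next (resume n))

      module _ (m : Monomial x) where

        -- The invariant of a run: the monomial `m` lies in the `k`-th domain, and the `k`-th
        -- iterate on it is `h` after an arrow of the free category. With `h` as a parameter,
        -- `proceed` can replace it within a step and `advance` can pass to the next step.
        record Reaches (k : ℕ) {z} (h : F₀ z ⇒ F₀ u +′ F₀ y) : Set (a ⊔ g ⊔ ℓ ⊔ e) where
          field
            point : F₀ (term m) ⇒ dom f′ k
            over  : dom-inj f′ k ∘ point ≈ F₁ (incl m)
            arrow : term m ⟶ z
            value : iterate f′ k ∘ point ≈ h ∘ F₁ arrow
        open Reaches

        Settled : Set (a ⊔ g ⊔ ℓ ⊔ e)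
        Settled = (F₀ (term m) ⇒ 𝟎) ⊎
          (Σ[ κ ∈ term m ⟶ y ] call f′ terminates ∘ F₁ (incl m) ≈ F₁ κ)

        begins : Reaches zero {term m} ((f′ ∘ inl) ∘ F₁ (incl m))
        begins = record
          { point = F₁ (incl m) ; over = idˡ ; arrow = idₜ ; value = Eq.sym (elimʳ F-id) }

        advance : ∀ {k s} → Reaches k {term s} (inl ∘ F₁ (incl s)) →
                  Reaches (suc k) {term s} ((f′ ∘ inr) ∘ F₁ (incl s))
        advance {k} r = record
          { point = Pullback.universal pb (Eq.trans (value r) assoc)
          ; over  = Eq.trans (pullʳ (Pullback.universal₁ pb)) (over r)
          ; arrow = arrow r
          ; value = Eq.trans (pullʳ (Pullback.universal₂ pb)) (Eq.sym assoc)
          }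
          where pb = preimageˡ (iterate f′ k)

        proceed : ∀ {k z h s} → Reaches k {z} h → (out : Outcome {z} h) → next out ≡ just s →
                  Reaches k {term s} (inl ∘ F₁ (incl s))
        proceed r (stay n κ p) ≡.refl = record
          { point = point r ; over = over r ; arrow = κ ∙ arrow r
          ; value = Eq.trans (value r) (Eq.trans (∘-congʳ p) (Eq.trans
              (pullʳ (F-resp-∙ ∙-assoc)) (Eq.trans (∘-congˡ F-∘) (Eq.sym assoc))))
          }

        -- On leaving, the point lifts to the `k`-th exit domain, where `call` is `exit-val`. On
        -- vanishing, the arrow travelled so far pulls emptiness back to `term m`.
        settle : ∀ {k z h} → Reaches k {z} h → (out : Outcome {z} h) → next out ≡ nothing →
                 Settled
        settle r (vanish z) _ = inj₁ (z ∘ F₁ (arrow r))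
        settle {k} r (leave n κ p) _ = inj₂ ((incl n ∙ κ) ∙ arrow r , (begin
          call f′ terminates ∘ F₁ (incl m)               ≈⟨ ∘-congˡ (over r) ⟨
          call f′ terminates ∘ (dom-inj f′ k ∘ point r)  ≈⟨ ∘-congˡ (pullʳ (Pullback.universal₁ pb)) ⟨
          call f′ terminates ∘ (exit-inj f′ k ∘ q)       ≈⟨ pullˡ (IsSum.cotuple-ι terminates k) ⟩
          exit-val f′ k ∘ q                              ≈⟨ Pullback.universal₂ pb ⟩
          F₁ ((incl n ∙ κ) ∙ arrow r)                    ∎))
          where
          pb = preimageʳ (iterate f′ k)
          q : F₀ (term m) ⇒ exit f′ k
          q = Pullback.universal pb (Eq.trans (value r) (Eq.trans (∘-congʳ p)
                (pullʳ (F-resp-∙ ∼refl))))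

        first : Maybe (Monomial u)
        first = next (launch m)

        reaches : ∀ k {s} → orbit k first ≡ just s → Reaches k {term s} (inl ∘ F₁ (incl s))
        reaches zero    eq = proceed begins (launch m) eq
        reaches (suc k) eq with orbit k first in eqₖ
        ... | just s = proceed (advance (reaches k eqₖ)) (resume s) eq

        halts : ∀ k → orbit k first ≡ nothing → Settled
        halts zero    eq = settle begins (launch m) eq
        halts (suc k) eq with orbit k first in eqₖ
        ... | just s  = settle (advance (reaches k eqₖ)) (resume s) eq
        -- The run had stopped before; the recursion goes back to the last live state, or to the
        -- launch.
        ... | nothing = halts k eqₖ

        settled : Settled
        settled with halts-or-loops first
        ... | inj₁ (k , eq) = halts k eq
        ... | inj₂ alive    = inj₁ (looping-empty f′ terminates m λ k →
          let r = reaches k (proj₂ (alive k)) in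
          point r , _ , over r , Eq.trans (value r) assoc)

      call∈ : InImage S {x} {y} (call f′ terminates)
      call∈ = InImage-cover _ member
        where
        member : ∀ m → InImage S {term m} {y} (call f′ terminates ∘ F₁ (incl m))
        member m with settled m
        ... | inj₁ z       = fromInitial (strict-initial z) _
        ... | inj₂ (κ , p) = image κ p

  -- Iterations that stop at the first step

  module _ {X U Y} (U-empty : U ⇒ 𝟎) (f : X +′ U ⇒ U +′ Y) (h : X ⇒ Y)
           (f-inl : f ∘ inl ≈ inr ∘ h) where

    private
      pb = preimageʳ (iterate f zero)

      enter : X ⇒ exit f zero
      enter = Pullback.universal pb (Eq.trans idʳ f-inl)

      exit-enter : exit-inj f zero ∘ enter ≈ id
      exit-enter = Eq.trans (∘-congʳ idˡ) (Pullback.universal₁ pb)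

      enter-exit : enter ∘ exit-inj f zero ≈ id
      enter-exit = Pullback.unique pb p₁-eq (inr-mono (begin
        inr ∘ (p₂ ∘ (enter ∘ exit-inj f zero))     ≈⟨ pullˡ (Eq.sym (Pullback.commute pb)) ⟩
        ((f ∘ inl) ∘ p₁) ∘ (enter ∘ exit-inj f zero) ≈⟨ pullʳ p₁-eq ⟩
        (f ∘ inl) ∘ (p₁ ∘ id)                      ≈⟨ pullˡ (Pullback.commute pb) ⟩
        (inr ∘ p₂) ∘ id                            ≈⟨ assoc ⟩
        inr ∘ (p₂ ∘ id)                            ∎))
        where
        open Pullback pb using (p₁; p₂)
        p₁-eq : p₁ ∘ (enter ∘ exit-inj f zero) ≈ p₁ ∘ id
        p₁-eq = Eq.trans (pullˡ (Pullback.universal₁ pb)) (Eq.trans idˡ (Eq.trans idˡ (Eq.sym idʳ)))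

      later-empty : ∀ k → exit f (suc k) ⇒ 𝟎
      later-empty k =
        U-empty ∘ Pullback.p₂ (preimageˡ (iterate f k)) ∘
        Pullback.p₁ (preimageʳ (iterate f (suc k)))

    -- The exit domain at step zero is all of `X` and the later ones map to `U`, hence are initial;
    -- a cotuple is therefore determined by its component at zero.
    immediate : Terminates f
    immediate = record
      { cotuple   = λ v → v zero ∘ enter
      ; cotuple-ι = λ { zero → Eq.trans (pullʳ enter-exit) idʳ ; (suc k) → strict (later-empty k) }
      ; cotuple!  = λ p → Eq.trans (Eq.sym (elimʳ exit-enter)) (pullˡ (p zero))
      }

    call-immediate : call f immediate ≈ h
    call-immediate = Pullback.universal₂ pb

  member-is-call : ∀ {x y} {h : F₀ x ⇒ F₀ y} → InImage S {x} {y} h →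
                   IterativeClosure ext (Image S) {x} {y} h
  member-is-call {x} {y} {h} h∈ =
    𝟘 , f , f∈ , immediate from-F𝟘 f′ h f′-inl , Eq.sym (call-immediate from-F𝟘 f′ h f′-inl)
    where
    f : F₀ (x ⊕ 𝟘) ⇒ F₀ (𝟘 ⊕ y)
    -- `[ idₜ ∣ ¡ ]` identifies `x ⊕ 𝟘` with `x`, and `in₂` sends every value of `h` straight to the
    -- exit summand.
    f = F₁ in₂ ∘ (h ∘ F₁ [ idₜ ∣ ¡ ])
    f∈ : InImage S {x ⊕ 𝟘} {𝟘 ⊕ y} f
    f∈ = compose Eq.refl (image in₂ Eq.refl) (compose Eq.refl h∈ (image _ Eq.refl))
    f′ : F₀ x +′ F₀ 𝟘 ⇒ F₀ 𝟘 +′ F₀ y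
    f′ = onSums ext (Image S) {x} {𝟘} {y} f
    forth : F₀ (𝟘 ⊕ y) ⇒ F₀ 𝟘 +′ F₀ y
    forth = IsCoproduct.copair F-sum inl inr
    f′-inl : f′ ∘ inl ≈ inr ∘ h
    f′-inl = begin
      f′ ∘ inl                                        ≈⟨ pullʳ (pullʳ copair₁) ⟩
      forth ∘ ((F₁ in₂ ∘ (h ∘ F₁ [ idₜ ∣ ¡ ])) ∘ F₁ in₁)
        ≈⟨ ∘-congˡ (pullʳ (pullʳ (F-resp-∙ [∣]-β₁))) ⟩
      forth ∘ (F₁ in₂ ∘ (h ∘ F₁ idₜ))                 ≈⟨ ∘-congˡ (∘-congˡ (elimʳ F-id)) ⟩
      forth ∘ (F₁ in₂ ∘ h)                            ≈⟨ pullˡ (IsCoproduct.copair₂ F-sum) ⟩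
      inr ∘ h                                         ∎

theorem26 : ∀ {a g o ℓ e : Level}
    (G : DistributiveGraph a g) (E : Category o ℓ e) (ext : IsExtensive E)
    (S : DistributiveFunctor (𝓕 G) E) →
    (∀ {x y} (t : DistributiveGraph.Arc G x y) → ¬ DistributiveGraph.IsControlFunction G t) →
    ∀ {x y} (h : Category._⇒_ E (DistributiveFunctor.F₀ S x) (DistributiveFunctor.F₀ S y)) →
    SubcategoryWithSums.Member (Image S) {x} {y} h ⇔ IterativeClosure ext (Image S) {x} {y} h
theorem26 G E ext S no-control {x} {y} h = mk⇔ member-is-call
  λ (u , f , f∈ , t , h≈) → InImage-resp (Category.Eq.sym E h≈)
    (Run.call∈ f (restricts no-control f∈) t)
  where
  open ImageLemmas ext S
  open CallLemmas ext S
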